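{- Let $G$ be a connected graph. Then $G$ is $[2,3]$-choosable if and only if the core of $G$ belongs (up to isomorphism) to $$\widetilde T=\{K_1\}\cup\{C_{2m+2} : m\geq 1\}\cup\{\theta_{2,2,2m}: m\geq 1\}\cup\{K_{2,m+3}: m\geq 1\}.$$
   Context: All graphs are finite and simple. A graph $G=(V,E)$ is $[\ell,k]$-choosable (with $k\ge \ell$) if for every assignment $L$ of lists $L(v)\subseteq\{1,\dots,k\}$ with $|L(v)|=\ell$ for all $v\in V$, there is a proper coloring $c$ of $G$ (that is, $c(u)\ne c(v)$ for every edge $uv$) with $c(v)\in L(v)$ for all $v\in V$. The lists need not use all colors of $\{1,\dots,k\}$. The core of a graph is the subgraph obtained by repeatedly removing a vertex of degree $1$ together with its incident edge until the graph contains only isolated vertices and vertices of degree at least $2$. $K_1$ is the one-vertex graph, $C_q$ is the cycle on $q$ vertices, $K_{p,q}$ is the complete bipartite graph with parts of sizes $p$ and $q$. For positive integers $a,b,c$, $\theta_{a,b,c}$ is the graph consisting of three internally vertex-disjoint paths of lengths (numbers of edges) $a,b,c$ between two fixed distinct vertices. -}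

module Defs where

open import Data.Nat using (ℕ; zero; suc; _+_; _*_; _≤_; _∸_; z≤n; s≤s)
import Data.Nat as ℕ
open import Data.Fin using (Fin; toℕ; punchIn)
import Data.Fin as Fin
open import Data.Fin.Properties using (any?)
open import Data.Fin.Subset using (Subset; _∈_; ∣_∣)
open import Data.List using (allFin; filter; length)
open import Data.Vec using ([]; _∷_; lookup)
open import Data.Product using (_×_; _,_; ∃; ∃-syntax; Σ-syntax)
open import Data.Sum using (_⊎_; inj₁; inj₂; swap)
import Data.Sum.Properties as Sum
open import Data.Unit using (⊤)
open import Data.Empty using (⊥; ⊥-elim)
open import Function.Bundles using (_↔_; _⇔_; Inverse)
open import Relation.Nullary using (yes; no; ¬?)
open import Relation.Nullary.Decidable using (_×-dec_; _⊎-dec_)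
open import Relation.Binary.Core using (Rel)
open import Relation.Binary.Definitions
  using (Decidable; DecidableEquality; Irreflexive; Symmetric)
open import Relation.Binary.Construct.Closure.ReflexiveTransitive using (Star)
open import Relation.Binary.PropositionalEquality using (_≡_; _≢_; refl; sym)
open import Level using (0ℓ)

-- Simple graphs on a vertex type.  Adjacency is decidable because all graphs
-- considered are finite combinatorial objects; a finite graph is a graph on
-- some Fin n.

record Graph (V : Set) : Set₁ where
  infix 4 _~_ _~?_
  field
    _~_    : Rel V 0ℓ
    _~?_   : Decidable _~_
    ~-sym  : Symmetric _~_
    ~-irr  : Irreflexive _≡_ _~_

infix 4 _≅_

_≅_ : {V W : Set} → Graph V → Graph W → Set
_≅_ {V} {W} G H =
  Σ[ f ∈ V ↔ W ] (∀ u v → u ~G v ⇔ Inverse.to f u ~H Inverse.to f v)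
  where
  open Graph G renaming (_~_ to _~G_)
  open Graph H renaming (_~_ to _~H_)

-- The empty graph is not connected.

Connected : {V : Set} → Graph V → Set
Connected {V} G = V × (∀ u v → Star (Graph._~_ G) u v)

-- [ℓ,k]-choosability (used for ℓ ≤ k), with Fin k as the set of colours.

Choosable : (ℓ k : ℕ) {V : Set} → Graph V → Set
Choosable ℓ k {V} G =
  (L : V → Subset k) → (∀ v → ∣ L v ∣ ≡ ℓ) →
  Σ[ c ∈ (V → Fin k) ] ((∀ u v → u ~ v → c u ≢ c v) × (∀ v → c v ∈ L v))
  where open Graph G

degree : ∀ {n} → Graph (Fin n) → Fin n → ℕ
degree {n} G v = length (filter (v ~?_) (allFin n))
  where open Graph G

infixl 6 _-_

-- Deletion of v; the other vertices are renumbered in order by punchIn v.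

_-_ : ∀ {n} → Graph (Fin (suc n)) → Fin (suc n) → Graph (Fin n)
G - v = record
  { _~_   = λ x y → punchIn v x ~ punchIn v y
  ; _~?_  = λ x y → punchIn v x ~? punchIn v y
  ; ~-sym = ~-sym
  ; ~-irr = λ { refl → ~-irr refl }
  }
  where open Graph G

infix 4 _prunesTo_ _IsCoreOf_

data _prunesTo_ : ∀ {n m} → Graph (Fin n) → Graph (Fin m) → Set₁ where
  stop  : ∀ {n} {G : Graph (Fin n)} → G prunesTo G
  prune : ∀ {n m} {G : Graph (Fin (suc n))} {H : Graph (Fin m)} v →
          degree G v ≡ 1 → G - v prunesTo H → G prunesTo H

-- The order of the removals is not fixed, so "the core" is a relation; it
-- determines H up to isomorphism only.

_IsCoreOf_ : ∀ {m n} → Graph (Fin m) → Graph (Fin n) → Set₁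
H IsCoreOf G = G prunesTo H × (∀ v → degree H v ≡ 0 ⊎ 2 ≤ degree H v)

core-exists : ∀ {n} (G : Graph (Fin n)) →
              ∃[ m ] Σ[ H ∈ Graph (Fin m) ] H IsCoreOf G
core-exists {zero}  G = zero , G , stop , λ ()
core-exists {suc n} G with any? (λ v → degree G v ℕ.≟ 1)
... | yes (v , deg≡1) with core-exists (G - v)
...   | m , H , p , d = m , H , prune v deg≡1 p , d
core-exists {suc n} G | no none = suc n , G , stop , λ v → 0or2≤ _ λ e → none (v , e)
  where
  0or2≤ : ∀ d → d ≢ 1 → d ≡ 0 ⊎ 2 ≤ d
  0or2≤ 0             _   = inj₁ refl
  0or2≤ 1             d≢1 = ⊥-elim (d≢1 refl)
  0or2≤ (suc (suc d)) _   = inj₂ (s≤s (s≤s z≤n))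

-- The simple graph generated by R: symmetrise and discard loops.

fromRel : {V : Set} → DecidableEquality V →
          (R : Rel V 0ℓ) → Decidable R → Graph V
fromRel _≟_ R R? = record
  { _~_   = λ u v → u ≢ v × (R u v ⊎ R v u)
  ; _~?_  = λ u v → ¬? (u ≟ v) ×-dec (R? u v ⊎-dec R? v u)
  ; ~-sym = λ { (u≢v , r) → (λ e → u≢v (sym e)) , swap r }
  ; ~-irr = λ { refl (u≢u , _) → u≢u refl }
  }

K : ∀ n → Graph (Fin n)
K n = fromRel Fin._≟_ (λ _ _ → ⊤) (λ _ _ → yes _)

-- The cycle 0, 1, …, q - 1, 0; meaningful for q ≥ 3.

C : ∀ q → Graph (Fin q)
C q = fromRel Fin._≟_
  (λ i j → suc (toℕ i) ≡ toℕ j ⊎ (suc (toℕ i) ≡ q × toℕ j ≡ 0))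
  (λ i j → (suc (toℕ i) ℕ.≟ toℕ j) ⊎-dec
           ((suc (toℕ i) ℕ.≟ q) ×-dec (toℕ j ℕ.≟ 0)))

module _ {p q : ℕ} where

  LeftRight : Rel (Fin p ⊎ Fin q) 0ℓ
  LeftRight (inj₁ _) (inj₂ _) = ⊤
  LeftRight _        _        = ⊥

  leftRight? : Decidable LeftRight
  leftRight? (inj₁ _) (inj₁ _) = no λ ()
  leftRight? (inj₁ _) (inj₂ _) = yes _
  leftRight? (inj₂ _) (inj₁ _) = no λ ()
  leftRight? (inj₂ _) (inj₂ _) = no λ ()

K[_,_] : ∀ p q → Graph (Fin p ⊎ Fin q)
K[ p , q ] = fromRel (Sum.≡-dec Fin._≟_ Fin._≟_) LeftRight leftRight?

-- Three paths between src and tgt, the i-th of length len i ≥ 1; inner i j is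
-- the vertex at distance j + 1 from src along the i-th path.

module Theta (len : Fin 3 → ℕ) where

  data Vertex : Set where
    src tgt : Vertex
    inner   : (i : Fin 3) → Fin (len i ∸ 1) → Vertex

  _≟_ : DecidableEquality Vertex
  src       ≟ src         = yes refl
  src       ≟ tgt         = no λ ()
  src       ≟ inner _ _   = no λ ()
  tgt       ≟ src         = no λ ()
  tgt       ≟ tgt         = yes refl
  tgt       ≟ inner _ _   = no λ ()
  inner _ _ ≟ src         = no λ ()
  inner _ _ ≟ tgt         = no λ ()
  inner i j ≟ inner i′ j′ with i Fin.≟ i′
  ... | no i≢i′ = no λ { refl → i≢i′ refl }
  ... | yes refl with j Fin.≟ j′
  ...   | no j≢j′  = no λ { refl → j≢j′ refl }
  ...   | yes refl = yes refl

  -- One step along a path, in the direction from src to tgt.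

  Step : Rel Vertex 0ℓ
  Step src         tgt           = ∃[ i ] len i ≡ 1
  Step src         (inner _ j)   = toℕ j ≡ 0
  Step (inner i j) (inner i′ j′) = i ≡ i′ × suc (toℕ j) ≡ toℕ j′
  Step (inner i j) tgt           = suc (suc (toℕ j)) ≡ len i
  Step _           _             = ⊥

  step? : Decidable Step
  step? src         src           = no λ ()
  step? src         tgt           = any? λ i → len i ℕ.≟ 1
  step? src         (inner _ j)   = toℕ j ℕ.≟ 0
  step? tgt         src           = no λ ()
  step? tgt         tgt           = no λ ()
  step? tgt         (inner _ _)   = no λ ()
  step? (inner _ _) src           = no λ ()
  step? (inner i j) tgt           = suc (suc (toℕ j)) ℕ.≟ len i
  step? (inner i j) (inner i′ j′) = (i Fin.≟ i′) ×-dec (suc (toℕ j) ℕ.≟ toℕ j′)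

  graph : Graph Vertex
  graph = fromRel _≟_ Step step?

lengths : (a b c : ℕ) → Fin 3 → ℕ
lengths a b c = lookup (a ∷ b ∷ c ∷ [])

θ : ∀ a b c → Graph (Theta.Vertex (lengths a b c))
θ a b c = Theta.graph (lengths a b c)

-- Membership, up to isomorphism, in the family T̃.

data InT {V : Set} (H : Graph V) : Set where
  isK₁   : H ≅ K 1 → InT H
  isC    : ∀ m → 1 ≤ m → H ≅ C (2 * m + 2) → InT H
  isθ    : ∀ m → 1 ≤ m → H ≅ θ 2 2 (2 * m) → InT H
  isK₂ₙ : ∀ m → 1 ≤ m → H ≅ K[ 2 , m + 3 ] → InT H

{-# OPTIONS --safe #-}

-- With three colours a list of size 2 is a single forbidden colour, and a path
-- is coloured by forced propagation.  Forbidding colours on a path with at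
-- least two inner vertices blocks any prescribed pair of end colours, one inner
-- vertex blocks only unequal pairs.  Hence two disjoint or touching cycles,
-- thetas with at most one path of length 2, and θ₂,₂,₂,r with r ≥ 3 are bad.
-- In a connected graph of minimum degree 2 a non-backtracking walk leaving a
-- subgraph covered by cycles returns to it as an ear, or closes a second cycle,
-- which is bad.  Starting from a cycle and adding ears, only θ₂,₂,₂ₘ and K₂,ₙ avoid
-- the bad subgraphs.  Conversely, on a path of even length at most one pair of
-- end colours, or two unequal pairs over the same two colours, are blocked, so
-- the ends of a cycle or of θ₂,₂,₂ₘ can be coloured.

module Submission where

open import Defs
open import Data.Nat using (ℕ)
open import Data.Fin using (Fin)
open import Function.Bundles using (_⇔_)
import Algebra.Solver.CommutativeMonoid as CommutativeMonoidSolver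
open import Data.Bool using (Bool; true; false; not)
open import Data.Empty using (⊥; ⊥-elim)
open import Data.Fin as Fin using (zero; suc; toℕ; punchIn; punchOut)
open import Data.Fin.Properties as Fin
  using (all?; any?; injective⇒≤; toℕ-injective; toℕ<n; punchInᵢ≢i; punchIn-injective;
         punchIn-punchOut; punchOut-punchIn; punchOut-cong)
open import Data.Fin.Subset using (Subset; ∣_∣; ∁; ⁅_⁆) renaming (_∈_ to _∈ˢ_)
open import Data.Fin.Subset.Properties using (x∈∁p⇒x∉p; x∈⁅x⁆)
open import Data.List
  using (List; []; _∷_; [_]; _++_; map; length; reverse; lookup; filter; allFin)
import Data.List.Membership.DecPropositional as DecMembership
open import Data.List.Membership.Propositional using (_∈_; _∉_)
open import Data.List.Membership.Propositional.Properties
  using (∈-∃++; ∈-++⁻; ∈-lookup; ∈-filter⁺; ∈-filter⁻; ∈-allFin)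
open import Data.List.Properties
  using (map-++; length-++; length-reverse; ++-assoc; ++-identityʳ; unfold-reverse; reverse-++)
open import Data.List.Relation.Binary.Permutation.Propositional
  using (_↭_; ↭-refl; ↭-sym; ↭-trans; ↭-prep; ↭-swap; ↭-reflexive; ↭⇒↭ₛ)
open import Data.List.Relation.Binary.Permutation.Propositional.Properties
  using (++-commutativeMonoid; ++-comm; ++⁺ˡ; ++⁺ʳ; shift; ↭-reverse; ↭-length; ∈-resp-↭; All-resp-↭)
import Data.List.Relation.Binary.Permutation.Setoid.Properties as Permutation
open import Data.List.Relation.Unary.All as All using (All; []; _∷_)
open import Data.List.Relation.Unary.All.Properties using (++⁻ˡ; ++⁻ʳ; ¬Any⇒All¬)
open import Data.List.Relation.Unary.Any using (here; there; index)
open import Data.List.Relation.Unary.Any.Properties using (lookup-index)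
open import Data.List.Relation.Unary.Unique.Propositional using (Unique; []; _∷_)
open import Data.List.Relation.Unary.Unique.Propositional.Properties using (allFin⁺; filter⁺)
open import Data.Nat as ℕ using (zero; suc; _+_; _*_; _∸_; _≤_; _<_; z≤n; s≤s)
import Data.Nat.Properties as ℕ
open import Data.Product using (_×_; _,_; proj₁; proj₂; ∃-syntax; Σ-syntax)
open import Data.Sum as Sum using (_⊎_; inj₁; inj₂; [_,_]′)
open import Data.Vec using ([]; _∷_; here; there)
open import Function using (_∘_; id)
open import Function.Bundles using (Equivalence; Inverse; mk⇔; mk↔ₛ′)
open import Relation.Binary.Construct.Closure.ReflexiveTransitive using (Star; ε; _◅_; kleisliStar)
open import Relation.Binary.Definitions using (DecidableEquality; tri<; tri≈; tri>)
open import Relation.Binary.PropositionalEquality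
  using (_≡_; _≢_; refl; sym; trans; cong; cong₂; subst; subst₂)
open import Relation.Binary.PropositionalEquality.Properties using (setoid)
open import Relation.Nullary using (¬_; Dec; yes; no; ¬?)
open import Relation.Nullary.Decidable using (from-yes; _×-dec_; _→-dec_)

-- Bad configurations are never formed as graphs: each is a tuple of paths given by their inner
-- vertices, with one `Unique` list of all vertices involved. Colours are prescribed as forbidden on
-- these vertices only and are arbitrary elsewhere, since every colouring of the whole graph
-- restricts to them. Blocking a prescribed pair can fail on a path with at most one inner vertex,
-- yet a bad theta may have such a third path. Here bipartiteness comes in: avoidability itself,
-- applied to a constant forbidden colour, yields a 2-colouring `β`. Forbidding the same colour
-- along the third path leaves only two pairs of end colours, one for each long path to block. `β`
-- also rules out triangles and settles the parities of the final shapes. A theta with two paths of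
-- length 2 admits no ear once its third path has two inner vertices. The exception θ₂,₂,₂ is K₂,₃,
-- which can still grow by ears of length 2 between its hubs.

Colour : Set
Colour = Fin 3

pattern c₀ = zero
pattern c₁ = suc zero
pattern c₂ = suc (suc zero)

-- third x x is some colour different from x.

third : Colour → Colour → Colour
third c₀ c₀ = c₁
third c₀ c₁ = c₂
third c₀ c₂ = c₁
third c₁ c₀ = c₂
third c₁ c₁ = c₀
third c₁ c₂ = c₀
third c₂ c₀ = c₁
third c₂ c₁ = c₀
third c₂ c₂ = c₀

third≢ˡ : ∀ x y → third x y ≢ x
third≢ˡ = from-yes (all? {3} λ x → all? {3} λ y → ¬? (third x y Fin.≟ x))

third≢ʳ : ∀ x y → third x y ≢ y
third≢ʳ = from-yes (all? {3} λ x → all? {3} λ y → ¬? (third x y Fin.≟ y))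

remaining : ∀ (a b x y : Colour) → a ≢ b → x ≢ a → x ≢ b → y ≢ a → y ≢ b → x ≡ y
remaining = from-yes (all? {3} λ a → all? {3} λ b → all? {3} λ x → all? {3} λ y →
  ¬? (a Fin.≟ b) →-dec ¬? (x Fin.≟ a) →-dec ¬? (x Fin.≟ b) →-dec
  ¬? (y Fin.≟ a) →-dec ¬? (y Fin.≟ b) →-dec (x Fin.≟ y))

module _ {V : Set} (G : Graph V) where
  open Graph G

  Proper : (V → Colour) → Set
  Proper c = ∀ u v → u ~ v → c u ≢ c v

  -- With three colours, a list of size 2 amounts to one forbidden colour.

  Avoidable : Set
  Avoidable = (f : V → Colour) →
    Σ[ c ∈ (V → Colour) ] (Proper c × (∀ v → c v ≢ f v))

-- Paths, and gadgets that force colours along them.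

module Paths {V : Set} (G : Graph V) where
  open Graph G public

  -- The list holds the inner vertices only: `[]` is an edge, and a cycle is a path with equal ends.
  -- Repetitions are excluded separately, by `Unique` hypotheses.
  Path : V → List V → V → Set
  Path u []       w = u ~ w
  Path u (x ∷ xs) w = u ~ x × Path x xs w

  concat : ∀ {u x w} xs {ys} → Path u xs x → Path x ys w → Path u (xs ++ x ∷ ys) w
  concat []       u~x       q = u~x , q
  concat (_ ∷ xs) (u~y , p) q = u~y , concat xs p q

  split : ∀ {u x w} xs {ys} → Path u (xs ++ x ∷ ys) w → Path u xs x × Path x ys w
  split []       p         = p
  split (_ ∷ xs) (u~y , p) with split xs p
  ... | q , r = (u~y , q) , r

  -- A partial assignment of forbidden colours to the vertices ks which forces P.

  Obeys : (V → Colour) → List (V × Colour) → Set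
  Obeys c = All λ (v , x) → c v ≢ x

  Gadget : List V → ((V → Colour) → Set) → Set
  Gadget ks P = Σ[ A ∈ List (V × Colour) ]
    (map proj₁ A ≡ ks × (∀ c → Proper G c → Obeys c A → P c))

  infixr 5 _⊗_

  -- Keys are merely concatenated. That no vertex receives two forbidden colours is checked once, in
  -- `refute`, on the finished configuration.
  _⊗_ : ∀ {ks ls P Q} → Gadget ks P → Gadget ls Q → Gadget (ks ++ ls) (λ c → P c × Q c)
  (A , a , p) ⊗ (B , b , q) =
    A ++ B , trans (map-++ proj₁ A B) (cong₂ _++_ a b) ,
    λ c prop ob → p c prop (++⁻ˡ A ob) , q c prop (++⁻ʳ A ob)

  weaken : ∀ {ks P Q} → (∀ c → Proper G c → P c → Q c) → Gadget ks P → Gadget ks Q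
  weaken h (A , a , p) = A , a , λ c prop ob → h c prop (p c prop ob)

  forbid : ∀ v x → Gadget [ v ] (λ c → c v ≢ x)
  forbid v x = [ (v , x) ] , refl , λ { _ _ (ne ∷ []) → ne }

  module _ (_≟_ : DecidableEquality V) where

    realise : ∀ A → Unique (map proj₁ A) → Σ[ f ∈ (V → Colour) ] All (λ (v , x) → f v ≡ x) A
    realise []            _         = (λ _ → c₀) , []
    realise ((v , x) ∷ A) (v∉ ∷ us) with realise A us
    ... | f , ok = g , g-v ∷ rest A v∉ ok
      where
      g : V → Colour
      g w with w ≟ v
      ... | yes _ = x
      ... | no  _ = f w
      g-v : g v ≡ x
      g-v with v ≟ v
      ... | yes _ = refl
      ... | no ne = ⊥-elim (ne refl)
      rest : ∀ B → All (v ≢_) (map proj₁ B) → All (λ (v , x) → f v ≡ x) B →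
             All (λ (v , x) → g v ≡ x) B
      rest []            _        _        = []
      rest ((w , y) ∷ B) (ne ∷ n) (e ∷ es) with w ≟ v
      ... | yes refl = ⊥-elim (ne refl)
      ... | no ne′   = trans g-w e ∷ rest B n es
        where
        g-w : g w ≡ f w
        g-w with w ≟ v
        ... | yes e = ⊥-elim (ne′ e)
        ... | no _  = refl

    refute : ∀ {ks} → Unique ks → Gadget ks (λ _ → ⊥) → ¬ Avoidable G
    refute us (A , refl , bad) av with realise A us
    ... | f , fA with av f
    ...   | c , prop , avoids = bad c prop
      (All.map (λ {(v , x)} e cv≡x → avoids v (trans cv≡x (sym e))) fA)


  -- One colour is taken by `u` and the third colour besides `x` and `x′` is forbidden, so `x′` is
  -- all that is left.
  force : ∀ {u} v → u ~ v → ∀ x x′ → x ≢ x′ → Gadget [ v ] (λ c → c u ≡ x → c v ≡ x′)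
  force {u} v u~v x x′ x≢x′ = weaken
    (λ c prop ne cu≡x → remaining x (third x x′) _ _ (third≢ˡ x x′ ∘ sym)
      (λ e → prop u v u~v (trans cu≡x (sym e))) ne
      (x≢x′ ∘ sym) (third≢ʳ x x′ ∘ sym))
    (forbid v (third x x′))

  -- Two inner vertices leave room for the intermediate colour `third x y`, which differs from both
  -- ends even if `x ≡ y`; propagation then gives the last inner vertex the colour `y`. On a longer
  -- path the first step may go to any colour other than `x`.
  block : ∀ {u w} ks → Path u ks w → 2 ≤ length ks →
          ∀ x y → Gadget ks (λ c → c u ≡ x → c w ≢ y)
  block []      _ ()
  block (_ ∷ []) _ (s≤s ())
  block {u} {w} (a ∷ b ∷ []) (u~a , a~b , b~w) _ x y = weaken
    (λ c prop (f , g) e e′ → prop b w b~w (trans (g (f e)) (sym e′)))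
    (force a u~a x z (third≢ˡ x y ∘ sym) ⊗ force b a~b z y (third≢ʳ x y))
    where z = third x y
  block (a ∷ ks@(_ ∷ _ ∷ _)) (u~a , p) _ x y = weaken
    (λ c prop (f , g) → g ∘ f)
    (force a u~a x (third x x) (third≢ˡ x x ∘ sym) ⊗ block ks p (s≤s (s≤s z≤n)) (third x x) y)

  block₁ : ∀ {u w} m → Path u [ m ] w → ∀ x y → x ≢ y →
           Gadget [ m ] (λ c → c u ≡ x → c w ≢ y)
  block₁ {u} {w} m (u~m , m~w) x y x≢y = weaken
    (λ c prop f e e′ → prop m w m~w (trans (f e) (sym e′)))
    (force m u~m x y x≢y)

  -- Works for every length, but the excluded colour cannot be prescribed: for a single edge it has
  -- to be `x`.
  chain : ∀ {u w} ks → Path u ks w → ∀ x → ∃[ y ] Gadget ks (λ c → c u ≡ x → c w ≢ y)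
  chain {u} {w} [] u~w x = x , [] , refl ,
    λ c prop _ e e′ → prop u w u~w (trans e (sym e′))
  chain (a ∷ ks) (u~a , p) x with chain ks p (third x x)
  ... | y , g = y , weaken (λ c prop (f , g) → g ∘ f)
    (force a u~a x (third x x) (third≢ˡ x x ∘ sym) ⊗ g)

-- Duplicate-free lists up to order.

module _ {A : Set} where

  Unique-resp-↭ : {xs ys : List A} → xs ↭ ys → Unique xs → Unique ys
  Unique-resp-↭ p = Permutation.Unique-resp-↭ (setoid A) (↭⇒↭ₛ p)

  Unique-++ˡ : ∀ (xs : List A) {ys} → Unique (xs ++ ys) → Unique xs
  Unique-++ˡ []       _        = []
  Unique-++ˡ (x ∷ xs) (n ∷ us) = ++⁻ˡ xs n ∷ Unique-++ˡ xs us

  Unique-++ʳ : ∀ (xs : List A) {ys} → Unique (xs ++ ys) → Unique ys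
  Unique-++ʳ []       us       = us
  Unique-++ʳ (x ∷ xs) (_ ∷ us) = Unique-++ʳ xs us

  infix 4 _⊑_

  -- Inclusion of multisets with an explicit complement. Every configuration lists its vertices in
  -- its own order; the commutative monoid solver supplies the permutation, and the complement takes
  -- the vertices left over.
  _⊑_ : List A → List A → Set
  xs ⊑ ys = Σ[ zs ∈ List A ] xs ++ zs ↭ ys

  Unique-⊑ : ∀ {xs ys} → xs ⊑ ys → Unique ys → Unique xs
  Unique-⊑ {xs} (_ , p) us = Unique-++ˡ xs (Unique-resp-↭ (↭-sym p) us)

  open CommutativeMonoidSolver (++-commutativeMonoid {A = A}) public
    using (solve; _⊜_; _⊕_)
    renaming (id to ∅)

-- The unavoidable subgraphs, and the bipartition.

module BadSubgraphs {V : Set} (_≟_ : DecidableEquality V) (G : Graph V)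
                    (av : Avoidable G) where
  open Paths G

  contradictory : ∀ {ks} → Unique ks → Gadget ks (λ _ → ⊥) → ⊥
  contradictory us g = refute _≟_ us g av

  -- `u` keeps `c₀` and `c₁`, and each cycle, as a closed path at `u`, blocks one of them.
  two-cycles : ∀ {u} p q → Unique (u ∷ p ++ q) → Path u p u → Path u q u →
               2 ≤ length p → 2 ≤ length q → ⊥
  two-cycles {u} p q us P Q 2≤p 2≤q = contradictory us
    (weaken (λ c _ (a , f , g) →
        a (remaining c₀ c₁ (c u) c₂ (λ ()) (λ e → f e e) (λ e → g e e) (λ ()) (λ ())))
      (forbid u c₂ ⊗ block p P 2≤p c₀ c₀ ⊗ block q Q 2≤q c₁ c₁))

  -- The first cycle forces `c₁` on `u`, so the connecting path excludes some `y` at `w`. Of the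
  -- other two colours one is forbidden outright and `z` is blocked by the second cycle.
  dumbbell : ∀ {u w} p q r → Unique (u ∷ w ∷ p ++ q ++ r) →
             Path u p u → Path w q w → Path u r w → 2 ≤ length p → 2 ≤ length q → ⊥
  dumbbell {u} {w} p q r us P Q R 2≤p 2≤q with chain r R c₁
  ... | y , g = contradictory
    (Unique-⊑ ([] , solve 5 (λ u w p q r → (u ⊕ p ⊕ r ⊕ w ⊕ q) ⊕ ∅ ⊜ u ⊕ w ⊕ p ⊕ q ⊕ r)
        ↭-refl [ u ] [ w ] p q r) us)
    (weaken (λ c _ (a , f , g , b , h) →
        b (remaining y z _ _ (third≢ˡ y y ∘ sym)
          (g (remaining c₀ c₂ _ _ (λ ()) (λ e → f e e) a (λ ()) (λ ())))
          (λ e → h e e) (third≢ˡ y z) (third≢ʳ y z)))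
      (forbid u c₂ ⊗ block p P 2≤p c₀ c₀ ⊗ g ⊗ forbid w (third y z) ⊗ block q Q 2≤q z z))
    where z = third y y

  -- `u` keeps `c₀` and `c₁`, `w` keeps `c₀` and `c₂`: four pairs of end colours for four paths.
  -- Exactly one of these pairs is equal, and it goes to `r`, since a single inner vertex blocks
  -- only unequal pairs.
  theta₂₂₂ : ∀ {u w} a b d r → Unique (u ∷ w ∷ a ∷ b ∷ d ∷ r) →
             Path u [ a ] w → Path u [ b ] w → Path u [ d ] w → Path u r w → 2 ≤ length r → ⊥
  theta₂₂₂ {u} {w} a b d r us A B D R 2≤r = contradictory us
    (weaken (λ c _ (nu , nw , f , g , h , k) →
        let w≡0 : c u ≢ c₀
            w≡0 e = nw (remaining c₀ c₂ _ _ (λ ()) (k e) (f e) (λ ()) (λ ()))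
        in nu (remaining c₀ c₁ _ _ (λ ()) w≡0
             (λ e → nw (remaining c₀ c₂ _ _ (λ ()) (g e) (h e) (λ ()) (λ ()))) (λ ()) (λ ())))
      (forbid u c₂ ⊗ forbid w c₁ ⊗ block₁ a A c₀ c₂ (λ ()) ⊗ block₁ b B c₁ c₀ (λ ())
        ⊗ block₁ d D c₁ c₂ (λ ()) ⊗ block r R 2≤r c₀ c₀))

  -- With `c₂` forbidden everywhere two colours remain, so `β` is a bipartition of `G`.
  β : V → Colour
  β = proj₁ (av (λ _ → c₂))

  β-proper : Proper G β
  β-proper = proj₁ (proj₂ (av (λ _ → c₂)))

  β≢2 : ∀ v → β v ≢ c₂
  β≢2 = proj₂ (proj₂ (av (λ _ → c₂)))

  β-other : ∀ {u v w} → β u ≢ β v → β w ≢ β v → β u ≡ β w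
  β-other {u} {v} {w} n n′ = remaining (β v) c₂ _ _ (β≢2 v) n (β≢2 u) n′ (β≢2 w)

  no-triangle : ∀ {u v w} → u ~ v → v ~ w → w ~ u → ⊥
  no-triangle {u} {v} {w} p q r = β-proper w u r
    (β-other (λ e → β-proper v w q (sym e)) (β-proper u v p))

  parity : ∀ {u w} ks → Path u ks w →
           (β u ≡ β w × ∃[ m ] length ks ≡ suc (m * 2)) ⊎ (β u ≢ β w × ∃[ m ] length ks ≡ m * 2)
  parity {u} {w} [] p = inj₂ (β-proper u w p , 0 , refl)
  parity {u} {w} (v ∷ ks) (p , q) with parity ks q
  ... | inj₁ (e , m , l) = inj₂ ((λ e′ → β-proper u v p (trans e′ (sym e))) , suc m , cong suc l)
  ... | inj₂ (n , m , l) = inj₁ (β-other (β-proper u v p) (n ∘ sym) , m , cong suc l)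

  -- Forbidding c₂ along a path makes a colouring copy β, or its opposite.

  transport : ∀ {u w} ks → Path u ks w →
              Gadget ks (λ c → c u ≢ c₂ → c w ≢ c₂ → (c u ≡ β u → c w ≡ β w) × (c u ≢ β u → c w ≢ β w))
  transport {u} {w} [] p = [] , refl , λ c prop _ → step c prop u w p
    where
    step : ∀ c → Proper G c → ∀ u w → u ~ w → c u ≢ c₂ → c w ≢ c₂ →
           (c u ≡ β u → c w ≡ β w) × (c u ≢ β u → c w ≢ β w)
    step c prop u w p nu nw =
      (λ e → remaining (c u) c₂ _ _ nu (prop u w p ∘ sym) nw
               (λ e′ → β-proper u w p (trans (sym e) (sym e′))) (β≢2 w)) ,
      (λ n e → prop u w p (trans (remaining (β u) c₂ _ _ (β≢2 u) n nu
               (β-proper u w p ∘ sym) (β≢2 w)) (sym e)))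
  transport {u} {w} (v ∷ ks) (p , q) = weaken
    (λ c prop (nv , f) nu nw →
      let g = proj₂ (proj₂ (transport [] p)) c prop [] nu nv ; h = f nv nw
      in proj₁ h ∘ proj₁ g , proj₂ h ∘ proj₂ g)
    (forbid v c₂ ⊗ transport ks q)

  -- With c₂ forbidden on r and its ends, only the two colour pairs that agree
  -- with β or with its opposite at both ends survive; p and q block them.

  theta : ∀ {u w} p q r → Unique (u ∷ w ∷ p ++ q ++ r) →
          Path u p w → Path u q w → Path u r w → 2 ≤ length p → 2 ≤ length q → ⊥
  theta {u} {w} p q r us P Q R 2≤p 2≤q = contradictory us
    (weaken (λ c _ (nu , nw , f , g , h) →
        let T = h nu nw
            nβ : c u ≢ β u
            nβ e = f e (proj₁ T e)
        in g (remaining (β u) c₂ _ _ (β≢2 u) nβ nu (third≢ˡ (β u) c₂) (third≢ʳ (β u) c₂))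
             (remaining (β w) c₂ _ _ (β≢2 w) (proj₂ T nβ) nw (third≢ˡ (β w) c₂) (third≢ʳ (β w) c₂)))
      (forbid u c₂ ⊗ forbid w c₂ ⊗ block p P 2≤p (β u) (β w)
        ⊗ block q Q 2≤q (third (β u) c₂) (third (β w) c₂) ⊗ transport r R))

private variable
  A : Set

Unique⇒lookup-injective : ∀ {xs : List A} → Unique xs → ∀ i j → lookup xs i ≡ lookup xs j → i ≡ j
Unique⇒lookup-injective (_ ∷ _)  zero    zero    _ = refl
Unique⇒lookup-injective (n ∷ _)  zero    (suc j) e = ⊥-elim (All.lookup n (∈-lookup j) e)
Unique⇒lookup-injective (n ∷ _)  (suc i) zero    e = ⊥-elim (All.lookup n (∈-lookup i) (sym e))
Unique⇒lookup-injective (_ ∷ us) (suc i) (suc j) e = cong suc (Unique⇒lookup-injective us i j e)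

Unique⇒length≤ : ∀ {n} {xs : List (Fin n)} → Unique xs → length xs ≤ n
Unique⇒length≤ us = injective⇒≤ (λ {i} {j} → Unique⇒lookup-injective us i j)

2≤length : ∀ (xs : List A) {y ys} → 1 ≤ length (xs ++ ys) → 2 ≤ length (xs ++ y ∷ ys)
2≤length []           {ys = _ ∷ _} _ = s≤s (s≤s z≤n)
2≤length (_ ∷ [])     _ = s≤s (s≤s z≤n)
2≤length (_ ∷ _ ∷ xs) _ = s≤s (s≤s z≤n)

∈⇒↭ : ∀ {x : A} {xs} → x ∈ xs → ∃[ ys ] xs ↭ x ∷ ys
∈⇒↭ x∈xs with ∈-∃++ x∈xs
... | ys , zs , refl = ys ++ zs , shift _ ys zs

∈-two : ∀ {x y : A} {xs} → x ∈ xs → y ∈ xs → x ≢ y →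
        (∃[ a ] ∃[ b ] ∃[ d ] xs ≡ a ++ x ∷ b ++ y ∷ d) ⊎
        (∃[ a ] ∃[ b ] ∃[ d ] xs ≡ a ++ y ∷ b ++ x ∷ d)
∈-two (here refl) (here refl) n = ⊥-elim (n refl)
∈-two (here refl) (there y∈) n with ∈-∃++ y∈
... | b , d , refl = inj₁ ([] , b , d , refl)
∈-two (there x∈) (here refl) n with ∈-∃++ x∈
... | b , d , refl = inj₂ ([] , b , d , refl)
∈-two (there x∈) (there y∈) n with ∈-two x∈ y∈ n
... | inj₁ (a , b , d , refl) = inj₁ (_ ∷ a , b , d , refl)
... | inj₂ (a , b , d , refl) = inj₂ (_ ∷ a , b , d , refl)

module PathReversal {V : Set} (G : Graph V) where
  open Paths G

  path-sym : ∀ {u w} ks → Path u ks w → Path w (reverse ks) u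
  path-sym []       p = ~-sym p
  path-sym (x ∷ ks) (u~x , p) rewrite unfold-reverse x ks =
    concat (reverse ks) (path-sym ks p) (~-sym u~x)

-- Non-backtracking walks that leave a vertex set.

module Search {n} (G : Graph (Fin n))
              (nbr : ∀ v p → ∃[ z ] (Graph._~_ G v z × z ≢ p)) where
  open Paths G
  open PathReversal G
  open DecMembership (Fin._≟_ {n}) using (_∈?_)

  V = Fin n

  -- In a `lollipop` the walk meets itself at `z`: `l` closes the new cycle and `b` is the tail from
  -- `z` to `s`.
  data Probe (S : List V) : Set where
    ear      : ∀ s z k → s ∈ S → z ∈ S → s ≢ z → 1 ≤ length k → Path s k z → Unique (k ++ S) → Probe S
    loop     : ∀ s k → s ∈ S → 2 ≤ length k → Path s k s → Unique (k ++ S) → Probe S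
    lollipop : ∀ s z l b → s ∈ S → 2 ≤ length l → Path z l z → Path z b s →
               Unique (z ∷ l ++ b ++ S) → Probe S

  -- The walk is kept newest vertex first: `y` is its current end and `ks` leads back to `s`. All
  -- vertices of the walk and of `S` are distinct, hence at most `n`, so the walk closes before
  -- `fuel` runs out.
  extend : ∀ {S s} → s ∈ S → ∀ fuel y ks → n < length (y ∷ ks ++ S) + fuel →
           Path y ks s → Unique (y ∷ ks ++ S) → Probe S
  close : ∀ {S s} → s ∈ S → ∀ fuel y ks → n < length (y ∷ ks ++ S) + fuel →
          Path y ks s → Unique (y ∷ ks ++ S) → ∀ z → y ~ z → z ∉ ks → (ks ≡ [] → z ≢ s) → Probe S

  extend s∈S fuel y [] bound p us with nbr y _
  ... | z , y~z , z≢s = close s∈S fuel y [] bound p us z y~z (λ ()) (λ _ → z≢s)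
  extend {S} {s} s∈S fuel y (x ∷ ks) bound p us with nbr y x
  ... | z , y~z , z≢x with z ∈? ks
  ...   | no z∉ks = close s∈S fuel y (x ∷ ks) bound p us z y~z
                      (λ { (here e) → z≢x e ; (there z∈) → z∉ks z∈ }) (λ ())
  -- `z` lies beyond the previous vertex `x`, so the cycle through `z`, `y` and `x` has at least
  -- three vertices.
  ...   | yes z∈ks with ∈-∃++ z∈ks
  ...     | a , b , refl with split (x ∷ a) p
  ...       | q , r = lollipop _ z (y ∷ x ∷ a) b s∈S (s≤s (s≤s z≤n)) (~-sym y~z , q) r
    (Unique-⊑ ([] , solve 6 (λ z y x a b S →
        (z ⊕ (y ⊕ x ⊕ a) ⊕ b ⊕ S) ⊕ ∅ ⊜ y ⊕ (x ⊕ a ⊕ z ⊕ b) ⊕ S) ↭-refl [ z ] [ y ] [ x ] a b S) us)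

  close {S} {s} s∈S fuel y ks bound p us z y~z z∉ks ne with z ∈? S
  ... | yes z∈S with z Fin.≟ s
  ...   | no z≢s = ear z s (y ∷ ks) z∈S s∈S z≢s (s≤s z≤n) (~-sym y~z , p) us
  close s∈S fuel y [] bound p us z y~z z∉ks ne | yes z∈S | yes refl = ⊥-elim (ne refl refl)
  close s∈S fuel y ks@(_ ∷ _) bound p us z y~z z∉ks ne | yes z∈S | yes refl =
    loop _ (y ∷ ks) s∈S (s≤s (s≤s z≤n)) (~-sym y~z , p) us
  close s∈S zero y ks bound p us z y~z z∉ks ne | no z∉S =
    ⊥-elim (ℕ.<⇒≱ bound (subst (_≤ n) (sym (ℕ.+-identityʳ _)) (Unique⇒length≤ us)))
  close s∈S (suc fuel) y ks bound p us z y~z z∉ks ne | no z∉S =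
    extend s∈S fuel z (y ∷ ks) (subst (n <_) (ℕ.+-suc _ fuel) bound) (~-sym y~z , p)
      (¬Any⇒All¬ _ z∉ ∷ us)
    where
    z∉ : z ∉ y ∷ ks ++ _
    z∉ (here refl) = ~-irr refl y~z
    z∉ (there z∈)  = [ z∉ks , z∉S ]′ (∈-++⁻ ks z∈)

  probe : ∀ {S s x} → Unique S → s ∈ S → x ∉ S → s ~ x → Probe S
  probe us s∈S x∉S s~x = extend s∈S n _ [] (s≤s (ℕ.m≤n+m n _)) (~-sym s~x) (¬Any⇒All¬ _ x∉S ∷ us)

-- Ears attached to a theta graph with two paths of length 2.

module Ears {V : Set} (_≟_ : DecidableEquality V) (G : Graph V) (av : Avoidable G) where
  open Paths G public
  open PathReversal G public
  open BadSubgraphs _≟_ G av public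

  -- The theta graph with hubs u and w and paths u p w, u q w and u R w.

  vertices : V → V → V → V → List V → List V
  vertices u w p q R = u ∷ w ∷ p ∷ q ∷ R

  record Θ (u w p q : V) (R : List V) : Set where
    constructor mkΘ
    field
      u~p    : u ~ p
      p~w    : p ~ w
      u~q    : u ~ q
      q~w    : q ~ w
      path   : Path u R w
      1≤R    : 1 ≤ length R
      unique : Unique (vertices u w p q R)
  open Θ

  flip↭ : ∀ u w p q R → vertices u w p q R ↭ vertices w u p q (reverse R)
  flip↭ u w p q R = ↭-swap u w (↭-prep p (↭-prep q (↭-sym (↭-reverse R))))

  swap↭ : ∀ u w p q R → vertices u w p q R ↭ vertices u w q p R
  swap↭ u w p q R = ↭-prep u (↭-prep w (↭-swap p q ↭-refl))

  flip : ∀ {u w p q R} → Θ u w p q R → Θ w u p q (reverse R)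
  flip {u} {w} {p} {q} {R} t = record
    { u~p = ~-sym (p~w t) ; p~w = ~-sym (u~p t) ; u~q = ~-sym (q~w t) ; q~w = ~-sym (u~q t)
    ; path = path-sym R (path t)
    ; 1≤R = subst (1 ≤_) (sym (length-reverse R)) (1≤R t)
    ; unique = Unique-resp-↭ (flip↭ u w p q R) (unique t) }

  swap : ∀ {u w p q R} → Θ u w p q R → Θ u w q p R
  swap {u} {w} {p} {q} {R} t = record
    { u~p = u~q t ; p~w = q~w t ; u~q = u~p t ; q~w = p~w t ; path = path t ; 1≤R = 1≤R t
    ; unique = Unique-resp-↭ (swap↭ u w p q R) (unique t) }

  -- The edge `u ~ p` becomes the short third path of a bad theta with hubs `u` and `p`; the long
  -- ones are the ear and the path through `q` and `w`. An ear with one inner vertex closes a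
  -- triangle.
  hub-mid : ∀ {u w p q R} → Θ u w p q R → ∀ k → 1 ≤ length k → Path u k p →
            Unique (k ++ vertices u w p q R) → ⊥
  hub-mid t (x ∷ []) _ (u~x , x~p) _ = no-triangle u~x x~p (~-sym (u~p t))
  hub-mid {u} {w} {p} {q} {R} t k@(_ ∷ _ ∷ _) _ P us = theta k (q ∷ w ∷ []) []
    (Unique-⊑ (R , solve 6 (λ k u w p q R → (u ⊕ p ⊕ k ⊕ (q ⊕ w) ⊕ ∅) ⊕ R ⊜ k ⊕ u ⊕ w ⊕ p ⊕ q ⊕ R)
      ↭-refl k [ u ] [ w ] [ p ] [ q ] R) us)
    P (u~q t , q~w t , ~-sym (p~w t)) (u~p t) (s≤s (s≤s z≤n)) (s≤s (s≤s z≤n))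

  mid-mid : ∀ {u w p q R} → Θ u w p q R → ∀ k → Path q k p →
            Unique (k ++ vertices u w p q R) → ⊥
  mid-mid t [] q~p _ = no-triangle (u~q t) q~p (~-sym (u~p t))
  mid-mid {u} {w} {p} {q} {R} t k@(_ ∷ _) P us = theta (q ∷ k) (R ++ [ w ]) []
    (Unique-⊑ ([] , solve 6 (λ k u w p q R → (u ⊕ p ⊕ (q ⊕ k) ⊕ (R ⊕ w) ⊕ ∅) ⊕ ∅
        ⊜ k ⊕ u ⊕ w ⊕ p ⊕ q ⊕ R)
      ↭-refl k [ u ] [ w ] [ p ] [ q ] R) us)
    (u~q t , P) (concat R (path t) (~-sym (p~w t))) (u~p t) (s≤s (s≤s z≤n))
    (subst (2 ≤_) (sym (length-++ R)) (subst (2 ≤_) (ℕ.+-comm 1 (length R)) (s≤s (1≤R t))))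

  path-mid : ∀ {u w p q} pre {r} post → Θ u w p q (pre ++ r ∷ post) → ∀ k → Path r k p →
             Unique (k ++ vertices u w p q (pre ++ r ∷ post)) → ⊥
  path-mid [] post t [] r~p _ = no-triangle (proj₁ (path t)) r~p (~-sym (u~p t))
  path-mid {u} {w} {p} {q} [] {r} post t k@(_ ∷ _) P us = theta (r ∷ k) (q ∷ w ∷ []) []
    (Unique-⊑ (post , solve 7 (λ k u w p q r b → (u ⊕ p ⊕ (r ⊕ k) ⊕ (q ⊕ w) ⊕ ∅) ⊕ b
        ⊜ k ⊕ u ⊕ w ⊕ p ⊕ q ⊕ r ⊕ b)
      ↭-refl k [ u ] [ w ] [ p ] [ q ] [ r ] post) us)
    (proj₁ (path t) , P) (u~q t , q~w t , ~-sym (p~w t)) (u~p t) (s≤s (s≤s z≤n)) (s≤s (s≤s z≤n))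
  path-mid {u} {w} {p} {q} pre@(_ ∷ _) {r} post t k P us = theta (pre ++ r ∷ k) (q ∷ w ∷ []) []
    (Unique-⊑ (post , solve 8 (λ k u w p q a r b → (u ⊕ p ⊕ (a ⊕ r ⊕ k) ⊕ (q ⊕ w) ⊕ ∅) ⊕ b
        ⊜ k ⊕ u ⊕ w ⊕ p ⊕ q ⊕ a ⊕ r ⊕ b)
      ↭-refl k [ u ] [ w ] [ p ] [ q ] pre [ r ] post) us)
    (concat pre (proj₁ (split pre (path t))) P) (u~q t , q~w t , ~-sym (p~w t)) (u~p t)
    (2≤length pre (s≤s z≤n)) (s≤s (s≤s z≤n))

  -- The 4-cycle through `p`, `w`, `q` and the cycle closed by the ear share only `u`. The length
  -- condition excludes the edge that joins `u` to the start of the path.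
  hub-path : ∀ {u w p q} pre {r} post → Θ u w p q (pre ++ r ∷ post) → ∀ k → Path r k u →
             1 ≤ length (pre ++ k) → Unique (k ++ vertices u w p q (pre ++ r ∷ post)) → ⊥
  hub-path {u} {w} {p} {q} pre {r} post t k P 1≤ us = two-cycles (p ∷ w ∷ q ∷ []) (pre ++ r ∷ k)
    (Unique-⊑ (post , solve 8 (λ k u w p q a r b → (u ⊕ (p ⊕ w ⊕ q) ⊕ (a ⊕ r ⊕ k)) ⊕ b
        ⊜ k ⊕ u ⊕ w ⊕ p ⊕ q ⊕ a ⊕ r ⊕ b)
      ↭-refl k [ u ] [ w ] [ p ] [ q ] pre [ r ] post) us)
    (u~p t , p~w t , ~-sym (q~w t) , ~-sym (u~q t)) (concat pre (proj₁ (split pre (path t))) P)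
    (s≤s (s≤s z≤n)) (2≤length pre 1≤)

  -- The ear closes a cycle with the stretch of the path from `x` to `y`, and the initial stretch
  -- `a` ties it to the 4-cycle at `u`.
  path-path : ∀ {u w p q} a {x} b {y} d → Θ u w p q (a ++ x ∷ b ++ y ∷ d) → ∀ k → Path y k x →
              1 ≤ length (b ++ k) → Unique (k ++ vertices u w p q (a ++ x ∷ b ++ y ∷ d)) → ⊥
  path-path {u} {w} {p} {q} a {x} b {y} d t k P 1≤ us =
    dumbbell (p ∷ w ∷ q ∷ []) (b ++ y ∷ k) a
    (Unique-⊑ (d , solve 10 (λ k u w p q a x b y d →
        (u ⊕ x ⊕ (p ⊕ w ⊕ q) ⊕ (b ⊕ y ⊕ k) ⊕ a) ⊕ d ⊜ k ⊕ u ⊕ w ⊕ p ⊕ q ⊕ a ⊕ x ⊕ b ⊕ y ⊕ d)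
      ↭-refl k [ u ] [ w ] [ p ] [ q ] a [ x ] b [ y ] d) us)
    (u~p t , p~w t , ~-sym (q~w t) , ~-sym (u~q t))
    (concat b (proj₁ (split b (proj₂ (split a (path t))))) P) (proj₁ (split a (path t)))
    (s≤s (s≤s z≤n)) (2≤length b 1≤)

  -- Here `2 ≤ length R` is essential: if `R` had one inner vertex, an ear of length 2 would just
  -- enlarge K₂,₃ to K₂,₄.
  hub-hub : ∀ {u w p q R} → Θ u w p q R → 2 ≤ length R → ∀ k → Path u k w →
            Unique (k ++ vertices u w p q R) → ⊥
  hub-hub t _ [] u~w _ = no-triangle (u~p t) (p~w t) (~-sym u~w)
  hub-hub {u} {w} {p} {q} {R} t 2≤R (x ∷ []) P us = theta₂₂₂ p q x R
    (Unique-⊑ ([] , solve 6 (λ k u w p q R → (u ⊕ w ⊕ p ⊕ q ⊕ k ⊕ R) ⊕ ∅ ⊜ k ⊕ u ⊕ w ⊕ p ⊕ q ⊕ R)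
      ↭-refl [ x ] [ u ] [ w ] [ p ] [ q ] R) us)
    (u~p t , p~w t) (u~q t , q~w t) P (path t) 2≤R
  hub-hub {u} {w} {p} {q} {R} t 2≤R k@(_ ∷ _ ∷ _) P us = theta k R [ p ]
    (Unique-⊑ ([ q ] , solve 6 (λ k u w p q R → (u ⊕ w ⊕ k ⊕ R ⊕ p) ⊕ q ⊜ k ⊕ u ⊕ w ⊕ p ⊕ q ⊕ R)
      ↭-refl k [ u ] [ w ] [ p ] [ q ] R) us)
    P (path t) (u~p t , p~w t) (s≤s (s≤s z≤n)) 2≤R

  1≤reverse : ∀ (k : List V) → 1 ≤ length k → 1 ≤ length (reverse k)
  1≤reverse k = subst (1 ≤_) (sym (length-reverse k))

  reverse-unique : ∀ k {S : List V} → Unique (k ++ S) → Unique (reverse k ++ S)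
  reverse-unique k = Unique-resp-↭ (++⁺ʳ _ (↭-sym (↭-reverse k)))

  1≤-++ʳ : ∀ (xs : List V) {ys} → 1 ≤ length ys → 1 ≤ length (xs ++ ys)
  1≤-++ʳ []      1≤ = 1≤
  1≤-++ʳ (_ ∷ _) _  = s≤s z≤n

  NoEar : List V → V → V → Set
  NoEar S s z = ∀ k → 1 ≤ length k → Path s k z → Unique (k ++ S) → ⊥

  noEar-sym : ∀ {S s z} → NoEar S s z → NoEar S z s
  noEar-sym h k 1≤ p us = h (reverse k) (1≤reverse k 1≤) (path-sym k p) (reverse-unique k us)

  noEar-resp : ∀ {S T s z} → S ↭ T → NoEar T s z → NoEar S s z
  noEar-resp e h k 1≤ p us = h k 1≤ p (Unique-resp-↭ (++⁺ˡ k e) us)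

  hub-noEar : ∀ {u w p q R} → Θ u w p q R → 2 ≤ length R → ∀ {z} →
              z ∈ vertices u w p q R → u ≢ z → NoEar (vertices u w p q R) u z
  hub-noEar t 2≤R (here refl) n = ⊥-elim (n refl)
  hub-noEar t 2≤R (there (here refl)) n k 1≤ P us = hub-hub t 2≤R k P us
  hub-noEar t 2≤R (there (there (here refl))) n k = hub-mid t k
  hub-noEar {u} {w} {p} {q} {R} t 2≤R (there (there (there (here refl)))) n =
    noEar-resp (swap↭ u w p q R) (hub-mid (swap t))
  hub-noEar {R = R} t 2≤R (there (there (there (there z∈)))) n with ∈-∃++ z∈
  ... | pre , post , refl = noEar-sym λ k 1≤ P → hub-path pre post t k P (1≤-++ʳ pre 1≤)

  mid-noEar : ∀ {u w p q R} → Θ u w p q R → 2 ≤ length R → ∀ {z} →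
              z ∈ vertices u w p q R → p ≢ z → NoEar (vertices u w p q R) p z
  mid-noEar t 2≤R (here refl) n = noEar-sym (hub-mid t)
  mid-noEar {u} {w} {p} {q} {R} t 2≤R (there (here refl)) n =
    noEar-resp (flip↭ u w p q R) (noEar-sym (hub-mid (flip t)))
  mid-noEar t 2≤R (there (there (here refl))) n = ⊥-elim (n refl)
  mid-noEar t 2≤R (there (there (there (here refl)))) n = noEar-sym λ k _ → mid-mid t k
  mid-noEar t 2≤R (there (there (there (there z∈)))) n with ∈-∃++ z∈
  ... | pre , post , refl = noEar-sym λ k _ → path-mid pre post t k

  Θ-noEar : ∀ {u w p q R} → Θ u w p q R → 2 ≤ length R → ∀ {s z} →
            s ∈ vertices u w p q R → z ∈ vertices u w p q R → s ≢ z →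
            NoEar (vertices u w p q R) s z
  Θ-noEar {u} {w} {p} {q} {R} t 2≤R = go
    where
    S = vertices u w p q R

    from-w : ∀ {z} → z ∈ S → w ≢ z → NoEar S w z
    from-w z∈ n = noEar-resp (flip↭ u w p q R)
      (hub-noEar (flip t) (subst (2 ≤_) (sym (length-reverse R)) 2≤R) (∈-resp-↭ (flip↭ u w p q R) z∈) n)

    from-q : ∀ {z} → z ∈ S → q ≢ z → NoEar S q z
    from-q z∈ n = noEar-resp (swap↭ u w p q R)
      (mid-noEar (swap t) 2≤R (∈-resp-↭ (swap↭ u w p q R) z∈) n)

    go : ∀ {s z} → s ∈ S → z ∈ S → s ≢ z → NoEar S s z
    go (here refl) z∈ n = hub-noEar t 2≤R z∈ n
    go (there (here refl)) z∈ n = from-w z∈ n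
    go (there (there (here refl))) z∈ n = mid-noEar t 2≤R z∈ n
    go (there (there (there (here refl)))) z∈ n = from-q z∈ n
    go s∈@(there (there (there (there _)))) (here refl) n =
      noEar-sym (hub-noEar t 2≤R s∈ (n ∘ sym))
    go s∈@(there (there (there (there _)))) (there (here refl)) n =
      noEar-sym (from-w s∈ (n ∘ sym))
    go s∈@(there (there (there (there _)))) (there (there (here refl))) n =
      noEar-sym (mid-noEar t 2≤R s∈ (n ∘ sym))
    go s∈@(there (there (there (there _)))) (there (there (there (here refl)))) n =
      noEar-sym (from-q s∈ (n ∘ sym))
    go (there (there (there (there s∈)))) (there (there (there (there z∈)))) n with ∈-two s∈ z∈ n
    ... | inj₁ (a , b , d , refl) = noEar-sym λ k 1≤ P → path-path a b d t k P (1≤-++ʳ b 1≤)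
    ... | inj₂ (a , b , d , refl) = λ k 1≤ P → path-path a b d t k P (1≤-++ʳ b 1≤)

-- Growing a spanning subgraph from a cycle.

module Structure {n} (G : Graph (Fin n)) (av : Avoidable G)
                 (nbr : ∀ v p → ∃[ z ] (Graph._~_ G v z × z ≢ p)) (conn : Connected G) where
  open Search G nbr
  open Ears Fin._≟_ G av
  open Θ
  open DecMembership (Fin._≟_ {n}) using (_∈?_)

  Spanning : List V → Set
  Spanning S = ∀ x → x ∈ S

  spanning? : ∀ S → Spanning S ⊎ ∃[ x ] x ∉ S
  spanning? S with any? (λ x → ¬? (x ∈? S))
  ... | yes x∉ = inj₂ x∉
  ... | no none = inj₁ λ x → case x (x ∈? S)
    where
    case : ∀ x → Dec (x ∈ S) → x ∈ S
    case x (yes x∈) = x∈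
    case x (no x∉)  = ⊥-elim (none (x , x∉))

  escape : ∀ {S s x} → Star _~_ s x → s ∈ S → x ∉ S → ∃[ y ] ∃[ z ] (y ∈ S × z ∉ S × y ~ z)
  escape ε s∈ x∉ = ⊥-elim (x∉ s∈)
  escape {S} (_◅_ {j = y} e es) s∈ x∉ with y ∈? S
  ... | yes y∈ = escape es y∈ x∉
  ... | no  y∉ = _ , y , s∈ , y∉ , e

  probe-outside : ∀ {S s x} → Unique S → s ∈ S → x ∉ S → Probe S
  probe-outside us s∈ x∉ with escape (proj₂ conn _ _) s∈ x∉
  ... | _ , _ , y∈ , z∉ , e = probe us y∈ z∉ e

  -- The invariant of the growing set. With a cycle of `S` through `s`, a loop at `s` gives two
  -- touching cycles and a lollipop gives a dumbbell, so only ears remain.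
  OnCycle : List V → V → Set
  OnCycle S s = ∃[ c ] (Path s c s × 2 ≤ length c × s ∷ c ⊑ S)

  Ear : List V → Set
  Ear S = ∃[ s ] ∃[ z ] ∃[ k ]
    (s ∈ S × z ∈ S × s ≢ z × 1 ≤ length k × Path s k z × Unique (k ++ S))

  only-ears : ∀ {S} → (∀ {s} → s ∈ S → OnCycle S s) → Probe S → Ear S
  only-ears cyc (ear s z k s∈ z∈ n 1≤ P us) = s , z , k , s∈ , z∈ , n , 1≤ , P , us
  only-ears cyc (loop s k s∈ 2≤ P us) with cyc s∈
  ... | c , C , 2≤c , zs , eq = ⊥-elim (two-cycles c k
    (Unique-⊑ (zs , ↭-trans (solve 4 (λ s c k zs → (s ⊕ c ⊕ k) ⊕ zs ⊜ k ⊕ ((s ⊕ c) ⊕ zs))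
      ↭-refl [ s ] c k zs) (++⁺ˡ k eq)) us) C P 2≤c 2≤)
  only-ears cyc (lollipop s z l b s∈ 2≤ L B us) with cyc s∈
  ... | c , C , 2≤c , zs , eq = ⊥-elim (dumbbell l c b
    (Unique-⊑ (zs , ↭-trans (solve 6 (λ s z l c b zs →
        (z ⊕ s ⊕ l ⊕ c ⊕ b) ⊕ zs ⊜ (z ⊕ l ⊕ b) ⊕ ((s ⊕ c) ⊕ zs))
      ↭-refl [ s ] [ z ] l c b zs)
      (↭-trans (++⁺ˡ (z ∷ l ++ b) eq) (↭-reflexive (cong (z ∷_) (++-assoc l b _))))) us)
    L C B 2≤ 2≤c)

  grow-or-span : ∀ {S s} → s ∈ S → Unique S → (∀ {s} → s ∈ S → OnCycle S s) → Spanning S ⊎ Ear S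
  grow-or-span {S} s∈ us cyc with spanning? S
  ... | inj₁ sp       = inj₁ sp
  ... | inj₂ (_ , x∉) = inj₂ (only-ears cyc (probe-outside us s∈ x∉))

  Θ-cycle : ∀ {u w p q R} → Θ u w p q R → ∀ {s} → s ∈ vertices u w p q R →
            OnCycle (vertices u w p q R) s
  Θ-cycle {u} {w} {p} {q} {R} t (here refl) = p ∷ w ∷ q ∷ [] ,
    (u~p t , p~w t , ~-sym (q~w t) , ~-sym (u~q t)) , s≤s (s≤s z≤n) , R ,
    solve 5 (λ u w p q R → (u ⊕ p ⊕ w ⊕ q) ⊕ R ⊜ u ⊕ w ⊕ p ⊕ q ⊕ R) ↭-refl [ u ] [ w ] [ p ] [ q ] R
  Θ-cycle {u} {w} {p} {q} {R} t (there (here refl)) = p ∷ u ∷ q ∷ [] ,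
    (~-sym (p~w t) , ~-sym (u~p t) , u~q t , q~w t) , s≤s (s≤s z≤n) , R ,
    solve 5 (λ u w p q R → (w ⊕ p ⊕ u ⊕ q) ⊕ R ⊜ u ⊕ w ⊕ p ⊕ q ⊕ R) ↭-refl [ u ] [ w ] [ p ] [ q ] R
  Θ-cycle {u} {w} {p} {q} {R} t (there (there (here refl))) = u ∷ q ∷ w ∷ [] ,
    (~-sym (u~p t) , u~q t , q~w t , ~-sym (p~w t)) , s≤s (s≤s z≤n) , R ,
    solve 5 (λ u w p q R → (p ⊕ u ⊕ q ⊕ w) ⊕ R ⊜ u ⊕ w ⊕ p ⊕ q ⊕ R) ↭-refl [ u ] [ w ] [ p ] [ q ] R
  Θ-cycle {u} {w} {p} {q} {R} t (there (there (there (here refl)))) = u ∷ p ∷ w ∷ [] ,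
    (~-sym (u~q t) , u~p t , p~w t , ~-sym (q~w t)) , s≤s (s≤s z≤n) , R ,
    solve 5 (λ u w p q R → (q ⊕ u ⊕ p ⊕ w) ⊕ R ⊜ u ⊕ w ⊕ p ⊕ q ⊕ R) ↭-refl [ u ] [ w ] [ p ] [ q ] R
  Θ-cycle {u} {w} {p} {q} t {s} (there (there (there (there s∈)))) with ∈-∃++ s∈
  ... | a , b , refl = b ++ w ∷ p ∷ u ∷ a ,
    concat b (proj₂ (split a (path t))) (~-sym (p~w t) , ~-sym (u~p t) , proj₁ (split a (path t))) ,
    2≤length b (1≤-++ʳ b (s≤s z≤n)) , [ q ] ,
    solve 7 (λ u w p q a s b → (s ⊕ b ⊕ w ⊕ p ⊕ u ⊕ a) ⊕ q ⊜ u ⊕ w ⊕ p ⊕ q ⊕ a ⊕ s ⊕ b)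
      ↭-refl [ u ] [ w ] [ p ] [ q ] a [ s ] b

  Θ-spanning : ∀ {u w p q R} → Θ u w p q R → 2 ≤ length R → Spanning (vertices u w p q R)
  Θ-spanning t 2≤R with grow-or-span (here refl) (unique t) (Θ-cycle t)
  ... | inj₁ sp = sp
  ... | inj₂ (s , z , k , s∈ , z∈ , n , 1≤ , P , us) = ⊥-elim (Θ-noEar t 2≤R s∈ z∈ n k 1≤ P us)

  -- K[2,n] for n ≥ 3, with parts {u, w} and ls.

  record Kθ (u w : V) (ls : List V) : Set where
    constructor mkKθ
    field
      joined  : All (λ l → u ~ l × l ~ w) ls
      3≤ls    : 3 ≤ length ls
      uniqueᴷ : Unique (u ∷ w ∷ ls)
  open Kθ

  permute : ∀ {u w ls ls′} → ls ↭ ls′ → Kθ u w ls → Kθ u w ls′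
  permute e (mkKθ j l us) = mkKθ (All-resp-↭ e j) (subst (3 ≤_) (↭-length e) l)
    (Unique-resp-↭ (↭-prep _ (↭-prep _ e)) us)

  flipᴷ : ∀ {u w ls} → Kθ u w ls → Kθ w u ls
  flipᴷ (mkKθ j l us) = mkKθ (All.map (λ (a , b) → ~-sym b , ~-sym a) j) l
    (Unique-resp-↭ (↭-swap _ _ ↭-refl) us)

  -- Three leaves already form K₂,₃, which is θ₂,₂,₂. With `permute` moving the relevant leaves to
  -- the front, the ear lemmas for `Θ` thus apply to K₂,ₙ.
  toΘ : ∀ {u w a b d ls} → Kθ u w (a ∷ b ∷ d ∷ ls) → Θ u w a b [ d ]
  toΘ {ls = ls} (mkKθ (ja ∷ jb ∷ jd ∷ _) _ us) = mkΘ (proj₁ ja) (proj₂ ja) (proj₁ jb) (proj₂ jb) jd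
    (s≤s z≤n) (Unique-⊑ (ls , ↭-refl) us)

  sub-ear : ∀ {u w a b d : V} ls k → Unique (k ++ u ∷ w ∷ a ∷ b ∷ d ∷ ls) →
            Unique (k ++ vertices u w a b [ d ])
  sub-ear {u} {w} {a} {b} {d} ls k us = Unique-⊑
    (ls , ↭-reflexive (++-assoc k _ ls)) us

  front₂ : ∀ {x y : V} {ls} → x ∈ ls → y ∈ ls → x ≢ y → ∃[ ls′ ] ls ↭ x ∷ y ∷ ls′
  front₂ {x} {y} x∈ y∈ n with ∈⇒↭ x∈
  ... | ls′ , e with ∈-resp-↭ e y∈
  ...   | here refl = ⊥-elim (n refl)
  ...   | there y∈′ with ∈⇒↭ y∈′
  ...     | ls″ , e′ = ls″ , ↭-trans e (↭-prep x e′)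

  leaf-leaf : ∀ {u w ls x y} → Kθ u w ls → x ∈ ls → y ∈ ls → x ≢ y → ∀ k → Path x k y →
              Unique (k ++ u ∷ w ∷ ls) → ⊥
  leaf-leaf {u} {w} {ls} {x} {y} t x∈ y∈ n k P us with front₂ x∈ y∈ n
  ... | ls′ , e = go ls′ (permute e t) (Unique-resp-↭ (++⁺ˡ k (↭-prep u (↭-prep w e))) us)
    where
    go : ∀ ls′ → Kθ u w (x ∷ y ∷ ls′) → Unique (k ++ u ∷ w ∷ x ∷ y ∷ ls′) → ⊥
    go [] (mkKθ _ (s≤s (s≤s ())) _) _
    go (d ∷ ls′) t us = mid-mid (swap (toΘ t)) k P
      (Unique-resp-↭ (++⁺ˡ k (swap↭ u w x y [ d ])) (sub-ear ls′ k us))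

  hub-leaf : ∀ {u w ls x} → Kθ u w ls → x ∈ ls → NoEar (u ∷ w ∷ ls) u x
  hub-leaf {u} {w} {ls} {x} t x∈ k 1≤ P us with ∈⇒↭ x∈
  ... | ls′ , e = go ls′ (permute e t) (Unique-resp-↭ (++⁺ˡ k (↭-prep u (↭-prep w e))) us)
    where
    go : ∀ ls′ → Kθ u w (x ∷ ls′) → Unique (k ++ u ∷ w ∷ x ∷ ls′) → ⊥
    go [] (mkKθ _ (s≤s ()) _) _
    go (_ ∷ []) (mkKθ _ (s≤s (s≤s ())) _) _
    go (b ∷ d ∷ ls′) t us = hub-mid (toΘ t) k 1≤ P (sub-ear ls′ k us)

  leaf-hub′ : ∀ {u w ls x} → Kθ u w ls → x ∈ ls → NoEar (u ∷ w ∷ ls) w x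
  leaf-hub′ t x∈ = noEar-resp (↭-swap _ _ ↭-refl) (hub-leaf (flipᴷ t) x∈)

  -- A longer ear between the hubs would be a fourth path beside three of length 2, as in
  -- `theta₂₂₂`; this is why three leaves are demanded from the start.
  new-leaf : ∀ {u w ls} → Kθ u w ls → ∀ k → Path u k w → 1 ≤ length k → Unique (k ++ u ∷ w ∷ ls) →
             ∃[ x ] Kθ u w (x ∷ ls)
  new-leaf {u} {w} {ls} (mkKθ j l us) (x ∷ []) P _ us′ = x , mkKθ (P ∷ j) (ℕ.m≤n⇒m≤1+n l)
    (Unique-⊑ ([] , solve 4 (λ u w x ls → (u ⊕ w ⊕ x ⊕ ls) ⊕ ∅ ⊜ x ⊕ u ⊕ w ⊕ ls)
        ↭-refl [ u ] [ w ] [ x ] ls) us′)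
  new-leaf {ls = []} (mkKθ _ () _) (_ ∷ _ ∷ _) _ _ _
  new-leaf {ls = _ ∷ []} (mkKθ _ (s≤s ()) _) (_ ∷ _ ∷ _) _ _ _
  new-leaf {ls = _ ∷ _ ∷ []} (mkKθ _ (s≤s (s≤s ())) _) (_ ∷ _ ∷ _) _ _ _
  new-leaf {u} {w} {a ∷ b ∷ d ∷ ls} (mkKθ (ja ∷ jb ∷ jd ∷ _) _ _) k@(_ ∷ _ ∷ _) P _ us =
    ⊥-elim (theta₂₂₂ a b d k
      (Unique-⊑ (ls , solve 4 (λ k h l ls → (h ⊕ l ⊕ k) ⊕ ls ⊜ k ⊕ h ⊕ l ⊕ ls)
        ↭-refl k (u ∷ w ∷ []) (a ∷ b ∷ d ∷ []) ls) us) ja jb jd P (s≤s (s≤s z≤n)))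

  K-grow : ∀ {u w ls} → Kθ u w ls → Ear (u ∷ w ∷ ls) → ∃[ x ] Kθ u w (x ∷ ls)
  K-grow t (s , z , k , here refl , here refl , n , 1≤ , P , us) = ⊥-elim (n refl)
  K-grow t (s , z , k , here refl , there (here refl) , n , 1≤ , P , us) = new-leaf t k P 1≤ us
  K-grow t (s , z , k , here refl , there (there z∈) , n , 1≤ , P , us) =
      ⊥-elim (hub-leaf t z∈ k 1≤ P us)
  K-grow t (s , z , k , there (here refl) , here refl , n , 1≤ , P , us) =
    new-leaf t (reverse k) (path-sym k P) (1≤reverse k 1≤) (reverse-unique k us)
  K-grow t (s , z , k , there (here refl) , there (here refl) , n , 1≤ , P , us) = ⊥-elim (n refl)
  K-grow t (s , z , k , there (here refl) , there (there z∈) , n , 1≤ , P , us) =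
      ⊥-elim (leaf-hub′ t z∈ k 1≤ P us)
  K-grow t (s , z , k , there (there s∈) , here refl , n , 1≤ , P , us) =
      ⊥-elim (noEar-sym (hub-leaf t s∈) k 1≤ P us)
  K-grow t (s , z , k , there (there s∈) , there (here refl) , n , 1≤ , P , us) =
      ⊥-elim (noEar-sym (leaf-hub′ t s∈) k 1≤ P us)
  K-grow t (s , z , k , there (there s∈) , there (there z∈) , n , 1≤ , P , us) =
      ⊥-elim (leaf-leaf t s∈ z∈ n k P us)

  K-cycle : ∀ {u w ls} → Kθ u w ls → ∀ {s} → s ∈ u ∷ w ∷ ls → OnCycle (u ∷ w ∷ ls) s
  K-cycle {ls = []} (mkKθ _ () _)
  K-cycle {ls = _ ∷ []} (mkKθ _ (s≤s ()) _)
  K-cycle {u} {w} {a ∷ b ∷ ls} (mkKθ (ja ∷ jb ∷ _) _ _) (here refl) = a ∷ w ∷ b ∷ [] ,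
    (proj₁ ja , proj₂ ja , ~-sym (proj₂ jb) , ~-sym (proj₁ jb)) , s≤s (s≤s z≤n) , ls ,
    ↭-prep u (↭-swap a w ↭-refl)
  K-cycle {u} {w} {a ∷ b ∷ ls} (mkKθ (ja ∷ jb ∷ _) _ _) (there (here refl)) = a ∷ u ∷ b ∷ [] ,
    (~-sym (proj₂ ja) , ~-sym (proj₁ ja) , proj₁ jb , proj₂ jb) , s≤s (s≤s z≤n) , ls ,
    solve 4 (λ u w a bs → w ⊕ a ⊕ u ⊕ bs ⊜ u ⊕ w ⊕ a ⊕ bs) ↭-refl [ u ] [ w ] [ a ] (b ∷ ls)
  K-cycle {u} {w} {ls@(_ ∷ _ ∷ _)} t {s} (there (there s∈)) with ∈⇒↭ s∈
  ... | ls′ , e = go ls′ (permute e t) e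
    where
    go : ∀ ls′ → Kθ u w (s ∷ ls′) → ls ↭ s ∷ ls′ → OnCycle (u ∷ w ∷ ls) s
    go [] (mkKθ _ (s≤s ()) _) _
    go (b ∷ ls′) (mkKθ (js ∷ jb ∷ _) _ _) e = u ∷ b ∷ w ∷ [] ,
      (~-sym (proj₁ js) , proj₁ jb , proj₂ jb , ~-sym (proj₂ js)) , s≤s (s≤s z≤n) , ls′ ,
      ↭-trans (solve 5 (λ u w s b ls → (s ⊕ u ⊕ b ⊕ w) ⊕ ls ⊜ u ⊕ w ⊕ s ⊕ b ⊕ ls)
        ↭-refl [ u ] [ w ] [ s ] [ b ] ls′) (↭-prep u (↭-prep w (↭-sym e)))

  K-spanning : ∀ fuel {u w ls} → n < length (u ∷ w ∷ ls) + fuel → Kθ u w ls →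
               ∃[ ls′ ] (Kθ u w ls′ × Spanning (u ∷ w ∷ ls′))
  K-spanning fuel {u} {w} {ls} bound t with grow-or-span (here refl) (uniqueᴷ t) (K-cycle t)
  ... | inj₁ sp = ls , t , sp
  K-spanning zero bound t | inj₂ _ =
    ⊥-elim (ℕ.<⇒≱ bound (subst (_≤ n) (sym (ℕ.+-identityʳ _)) (Unique⇒length≤ (uniqueᴷ t))))
  K-spanning (suc fuel) bound t | inj₂ e with K-grow t e
  ... | x , t′ = K-spanning fuel (subst (n <_) (ℕ.+-suc _ fuel) bound) t′

  -- Cycles, their ears, and the three possible shapes.

  chord : ∀ {u w} p q → u ~ w → Path u p w → Path u q w → 1 ≤ length p → 1 ≤ length q →
          Unique (u ∷ w ∷ p ++ q) → ⊥
  chord (x ∷ []) q e (a , b) Q _ _ _ = no-triangle a b (~-sym e)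
  chord (_ ∷ _ ∷ _) (x ∷ []) e P (a , b) _ _ _ = no-triangle a b (~-sym e)
  chord {u} {w} p@(_ ∷ _ ∷ _) q@(_ ∷ _ ∷ _) e P Q _ _ us = theta p q []
    (Unique-⊑ ([] , solve 3 (λ h p q → (h ⊕ p ⊕ q ⊕ ∅) ⊕ ∅ ⊜ h ⊕ p ⊕ q) ↭-refl (u ∷ w ∷ []) p q) us)
    P Q e (s≤s (s≤s z≤n)) (s≤s (s≤s z≤n))

  SomeΘ : Set
  SomeΘ = ∃[ u ] ∃[ w ] ∃[ p ] ∃[ q ] ∃[ R ] Θ u w p q R

  -- Two paths with at least two inner vertices each would give a bad theta, so at most one of the
  -- three is long, and it takes the place of `R`.
  classify : ∀ {u w} p q r → Unique (u ∷ w ∷ p ++ q ++ r) → Path u p w → Path u q w → Path u r w →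
             1 ≤ length p → 1 ≤ length q → 1 ≤ length r → SomeΘ
  classify (x ∷ []) (y ∷ []) r us P Q R _ _ 1≤r =
    _ , _ , x , y , r , mkΘ (proj₁ P) (proj₂ P) (proj₁ Q) (proj₂ Q) R 1≤r us
  classify {u} {w} (x ∷ []) q@(_ ∷ _ ∷ _) (z ∷ []) us P Q R _ 1≤q _ =
    _ , _ , x , z , q , mkΘ (proj₁ P) (proj₂ P) (proj₁ R) (proj₂ R) Q 1≤q
      (Unique-⊑ ([] , solve 4 (λ h x q z → (h ⊕ x ⊕ z ⊕ q) ⊕ ∅ ⊜ h ⊕ x ⊕ q ⊕ z)
          ↭-refl (u ∷ w ∷ []) [ x ] q [ z ]) us)
  classify {u} {w} p@(x ∷ []) q@(_ ∷ _ ∷ _) r@(_ ∷ _ ∷ _) us P Q R _ _ _ = ⊥-elim (theta q r p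
      (Unique-⊑ ([] , solve 4 (λ h x q z → (h ⊕ q ⊕ z ⊕ x) ⊕ ∅ ⊜ h ⊕ x ⊕ q ⊕ z)
          ↭-refl (u ∷ w ∷ []) p q r) us)
      Q R P (s≤s (s≤s z≤n)) (s≤s (s≤s z≤n)))
  classify {u} {w} p@(_ ∷ _ ∷ _) q@(_ ∷ _ ∷ _) r us P Q R _ _ _ =
    ⊥-elim (theta p q r us P Q R (s≤s (s≤s z≤n)) (s≤s (s≤s z≤n)))
  classify {u} {w} p@(_ ∷ _ ∷ _) (y ∷ []) (z ∷ []) us P Q R 1≤p _ _ =
    _ , _ , y , z , p , mkΘ (proj₁ Q) (proj₂ Q) (proj₁ R) (proj₂ R) P 1≤p
      (Unique-⊑ ([] , solve 4 (λ h p y z → (h ⊕ y ⊕ z ⊕ p) ⊕ ∅ ⊜ h ⊕ p ⊕ y ⊕ z)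
          ↭-refl (u ∷ w ∷ []) p [ y ] [ z ]) us)
  classify {u} {w} p@(_ ∷ _ ∷ _) q@(_ ∷ []) r@(_ ∷ _ ∷ _) us P Q R _ _ _ = ⊥-elim (theta p r q
      (Unique-⊑ ([] , solve 4 (λ h x q z → (h ⊕ x ⊕ z ⊕ q) ⊕ ∅ ⊜ h ⊕ x ⊕ q ⊕ z)
          ↭-refl (u ∷ w ∷ []) p q r) us)
      P R Q (s≤s (s≤s z≤n)) (s≤s (s≤s z≤n)))

  record Cycle (v : V) (ks : List V) : Set where
    constructor mkCycle
    field
      closed  : Path v ks v
      2≤ks    : 2 ≤ length ks
      uniqueᶜ : Unique (v ∷ ks)
  open Cycle

  rotate : ∀ {v ks} → Path v ks v → ∀ pre {s} post → v ∷ ks ≡ pre ++ s ∷ post → Path s (post ++ pre) s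
  rotate {ks = ks} P []        post refl rewrite ++-identityʳ ks = P
  rotate           P (_ ∷ pre) post refl = concat post (proj₂ (split pre P)) (proj₁ (split pre P))

  arcs : ∀ {v ks} → Cycle v ks → ∀ {s z} → s ∈ v ∷ ks → z ∈ v ∷ ks → s ≢ z →
         ∃[ a ] ∃[ b ] (Path s a z × Path z b s × 1 ≤ length (a ++ b) × s ∷ z ∷ a ++ b ↭ v ∷ ks)
  arcs {v} {ks} t {s} {z} s∈ z∈ n with ∈-∃++ s∈
  ... | pre , post , eq with rotate (closed t) pre post eq
                           | ↭-trans (↭-reflexive eq)
                               (↭-trans (shift s pre post) (↭-prep s (++-comm pre post)))
  ...   | P | e with ∈-resp-↭ e z∈
  ...     | here refl = ⊥-elim (n refl)
  ...     | there z∈′ with post ++ pre | ∈-∃++ z∈′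
  ...       | _ | a , b , refl = a , b , proj₁ (split a P) , proj₂ (split a P) ,
    ℕ.≤-pred (subst (2 ≤_) (trans (ℕ.suc-injective (↭-length e)) (↭-length (shift z a b))) (2≤ks t)) ,
    ↭-sym (↭-trans e (↭-prep s (shift z a b)))

  cycle-ear : ∀ {v ks} → Cycle v ks → Ear (v ∷ ks) → SomeΘ
  cycle-ear {v} {ks} t (s , z , k , s∈ , z∈ , n , 1≤k , K , us) with arcs t s∈ z∈ n
  ... | a , b , A , B , 1≤ab , e = go a b A B 1≤ab
      (Unique-resp-↭ (↭-trans (++⁺ˡ k (↭-sym e)) (solve 4 (λ k h a b → k ⊕ h ⊕ a ⊕ b ⊜ h ⊕ a ⊕ b ⊕ k)
          ↭-refl k (s ∷ z ∷ []) a b)) us)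
    where
    go : ∀ a b → Path s a z → Path z b s → 1 ≤ length (a ++ b) → Unique (s ∷ z ∷ a ++ b ++ k) → SomeΘ
    -- The ends of the ear are adjacent on the cycle, so their edge is a chord of the cycle made of
    -- the other arc and the ear.
    go [] b A B 1≤b us = ⊥-elim (chord (reverse b) k A (path-sym b B) K (1≤reverse b 1≤b) 1≤k
      (Unique-resp-↭ (↭-prep s (↭-prep z (++⁺ʳ k (↭-sym (↭-reverse b))))) us))
    go a@(_ ∷ _) [] A B _ us = ⊥-elim (chord a k (~-sym B) A K (s≤s z≤n) 1≤k us)
    go a@(_ ∷ _) b@(_ ∷ _) A B _ us = classify a (reverse b) k
      (Unique-resp-↭ (↭-prep s (↭-prep z (++⁺ˡ a (++⁺ʳ k (↭-sym (↭-reverse b)))))) us)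
      A (path-sym b B) K (s≤s z≤n) (1≤reverse b (s≤s z≤n)) 1≤k

  cycle-cycle : ∀ {v ks} → Cycle v ks → ∀ {s} → s ∈ v ∷ ks → OnCycle (v ∷ ks) s
  cycle-cycle {v} {ks} t {s} s∈ with ∈-∃++ s∈
  ... | pre , post , eq = post ++ pre , rotate (closed t) pre post eq ,
    subst (2 ≤_) (sym (ℕ.suc-injective (↭-length e))) (2≤ks t) , [] ,
    ↭-trans (↭-reflexive (++-identityʳ _)) e
    where
    e : s ∷ post ++ pre ↭ v ∷ ks
    e = ↭-sym (↭-trans (↭-reflexive eq) (↭-trans (shift s pre post) (↭-prep s (++-comm pre post))))

  -- A single vertex cannot carry an ear, and both other outcomes of a probe contain a cycle.
  find-cycle : V → ∃[ v ] ∃[ ks ] Cycle v ks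
  find-cycle v₀ with nbr v₀ v₀
  ... | x , e , x≢v₀ with probe {[ v₀ ]} ([] ∷ []) (here refl) (λ { (here e) → x≢v₀ e }) e
  ...   | ear _ _ _ (here refl) (here refl) n _ _ _ = ⊥-elim (n refl)
  ...   | loop s k (here refl) 2≤ P us = s , k , mkCycle P 2≤
    (Unique-⊑ ([] , solve 2 (λ s k → (s ⊕ k) ⊕ ∅ ⊜ k ⊕ s) ↭-refl [ s ] k) us)
  ...   | lollipop s z l b _ 2≤ P _ us = z , l , mkCycle P 2≤ (Unique-++ˡ (z ∷ l) us)

  -- K₂,₃ is filed under `thetoid` as θ₂,₂,₂, hence the four leaves in `bipartite`.
  data Shape : Set where
    cyclic   : ∀ {v ks} → Cycle v ks → Spanning (v ∷ ks) → Shape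
    thetoid  : ∀ {u w p q R} → Θ u w p q R → Spanning (vertices u w p q R) → Shape
    bipartite : ∀ {u w ls} → Kθ u w ls → 4 ≤ length ls → Spanning (u ∷ w ∷ ls) → Shape

  shape-Θ : SomeΘ → Shape
  shape-Θ (u , w , p , q , R@(_ ∷ _ ∷ _) , t) = thetoid t (Θ-spanning t (s≤s (s≤s z≤n)))
  shape-Θ (u , w , p , q , [] , mkΘ _ _ _ _ _ () _)
  shape-Θ (u , w , p , q , r ∷ [] , t) with K-spanning n (s≤s (ℕ.m≤n+m n _))
    (mkKθ ((u~p t , p~w t) ∷ (u~q t , q~w t) ∷ path t ∷ []) (s≤s (s≤s (s≤s z≤n))) (unique t))
  ... | []              , mkKθ _ () _ , _
  ... | _ ∷ []          , mkKθ _ (s≤s ()) _ , _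
  ... | _ ∷ _ ∷ []      , mkKθ _ (s≤s (s≤s ())) _ , _
  ... | _ ∷ _ ∷ _ ∷ []  , t′ , sp = thetoid (toΘ t′) sp
  ... | _ ∷ _ ∷ _ ∷ _ ∷ _ , t′ , sp = bipartite t′ (s≤s (s≤s (s≤s (s≤s z≤n)))) sp

  shape : Shape
  shape with find-cycle (proj₁ conn)
  ... | v , ks , t with grow-or-span (here refl) (uniqueᶜ t) (cycle-cycle t)
  ...   | inj₁ sp = cyclic t sp
  ...   | inj₂ e  = shape-Θ (cycle-ear t e)

-- Isomorphisms with the members of the family.

module _ {V W : Set} (H : Graph V) (K : Graph W) where
  open Graph

  bijection⇒≅ : (f : W → V) → (∀ a b → f a ≡ f b → a ≡ b) → (∀ v → ∃[ a ] f a ≡ v) →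
                (∀ a b → _~_ K a b → _~_ H (f a) (f b)) →
                (∀ a b → _~_ H (f a) (f b) → _~_ K a b) → H ≅ K
  bijection⇒≅ f inj surj preserves reflects =
    mk↔ₛ′ g f (λ a → inj _ _ (proj₂ (surj (f a)))) (λ v → proj₂ (surj v)) ,
    λ u v → mk⇔
      (λ e → reflects _ _ (subst₂ (_~_ H) (sym (proj₂ (surj u))) (sym (proj₂ (surj v))) e))
      (λ e → subst₂ (_~_ H) (proj₂ (surj u)) (proj₂ (surj v)) (preserves _ _ e))
    where
    g : V → W
    g v = proj₁ (surj v)

lookup-split : ∀ (xs : List A) i → ∃[ a ] ∃[ b ] (xs ≡ a ++ lookup xs i ∷ b × length a ≡ toℕ i)
lookup-split (x ∷ xs) zero = [] , xs , refl , refl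
lookup-split (x ∷ xs) (suc i) with lookup-split xs i
... | a , b , eq , l = x ∷ a , b , cong (x ∷_) eq , cong suc l

lookup-split₂ : ∀ (xs : List A) i j → toℕ i < toℕ j → ∃[ a ] ∃[ b ] ∃[ d ]
                (xs ≡ a ++ lookup xs i ∷ b ++ lookup xs j ∷ d ×
                 length a ≡ toℕ i × suc (toℕ i + length b) ≡ toℕ j)
lookup-split₂ (x ∷ xs) zero (suc j) _ with lookup-split xs j
... | b , d , eq , l = [] , b , d , cong (x ∷_) eq , refl , cong suc l
lookup-split₂ (x ∷ xs) (suc i) (suc j) (s≤s i<j) with lookup-split₂ xs i j i<j
... | a , b , d , eq , l , l′ = x ∷ a , b , d , cong (x ∷_) eq , cong suc l , cong suc l′

length≡0 : ∀ (xs : List A) → length xs ≡ 0 → xs ≡ []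
length≡0 [] _ = refl

empty-or-1≤ : ∀ (xs : List A) → xs ≡ [] ⊎ 1 ≤ length xs
empty-or-1≤ []      = inj₁ refl
empty-or-1≤ (_ ∷ _) = inj₂ (s≤s z≤n)

module Recognition {n} (G : Graph (Fin n)) (av : Avoidable G)
                   (nbr : ∀ v p → ∃[ z ] (Graph._~_ G v z × z ≢ p)) (conn : Connected G) where
  open Structure G av nbr conn
  open Search G nbr using (V)
  open Ears Fin._≟_ G av
  open Θ
  open Kθ
  open Cycle

  lookup-surjective : ∀ {S} → Spanning S → ∀ v → ∃[ i ] lookup S i ≡ v
  lookup-surjective sp v = index (sp v) , sym (lookup-index (sp v))

  arcs-at : ∀ {v ks} → Path v ks v → ∀ a {x} b {y} d → v ∷ ks ≡ a ++ x ∷ b ++ y ∷ d →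
            Path x b y × Path y (d ++ a) x
  arcs-at P a {x} b {y} d eq =
    split b (subst (λ l → Path x l x) (++-assoc b (y ∷ d) a) (rotate P a (b ++ y ∷ d) eq))

  -- With nonempty arcs on both sides the edge contradicts `chord`. An empty `d ++ a` stands for the
  -- closing edge between the first and the last vertex.
  chordless : ∀ {v ks} → Cycle v ks → ∀ a {x} b {y} d → v ∷ ks ≡ a ++ x ∷ b ++ y ∷ d →
              x ~ y → b ≡ [] ⊎ d ++ a ≡ []
  chordless t a {x} b {y} d eq e with arcs-at (closed t) a b d eq | empty-or-1≤ b | empty-or-1≤ (d ++ a)
  ... | _     | inj₁ b≡[] | _         = inj₁ b≡[]
  ... | _     | inj₂ _    | inj₁ []≡  = inj₂ []≡
  ... | P , Q | inj₂ 1≤b  | inj₂ 1≤da = ⊥-elim (chord b (reverse (d ++ a)) e P (path-sym (d ++ a) Q) 1≤b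
    (1≤reverse (d ++ a) 1≤da)
    (Unique-⊑ ([] , ↭-trans (↭-reflexive (++-identityʳ _))
      (↭-trans (↭-prep x (↭-prep y (++⁺ˡ b (↭-reverse (d ++ a)))))
      (solve 5 (λ a x b y d → x ⊕ y ⊕ b ⊕ d ⊕ a ⊜ a ⊕ x ⊕ b ⊕ y ⊕ d) ↭-refl a [ x ] b [ y ] d)))
      (subst Unique eq (uniqueᶜ t))))

  cycle-≅ : ∀ {v ks} → Cycle v ks → Spanning (v ∷ ks) → G ≅ C (length (v ∷ ks))
  cycle-≅ {v} {ks} t sp =
      bijection⇒≅ G (C (length (v ∷ ks))) (lookup xs) (Unique⇒lookup-injective (uniqueᶜ t))
    (lookup-surjective sp) preserves reflects
    where
    xs = v ∷ ks
    q = length xs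

    Next : Fin q → Fin q → Set
    Next i j = suc (toℕ i) ≡ toℕ j ⊎ (suc (toℕ i) ≡ q × toℕ j ≡ 0)

    next-edge : ∀ i j → i ≢ j → Next i j → lookup xs i ~ lookup xs j
    next-edge i j _ (inj₁ e) with lookup-split₂ xs i j (ℕ.≤-reflexive e)
    ... | a , b , d , eq , _ , l with length≡0 b (ℕ.+-cancelˡ-≡ (toℕ i) _ _
            (trans (ℕ.suc-injective (trans l (sym e))) (sym (ℕ.+-identityʳ _))))
    ...   | refl = proj₁ (arcs-at (closed t) a [] d eq)
    next-edge i j i≢j (inj₂ (e , j≡0)) with lookup-split₂ xs j i (ℕ.≤∧≢⇒< (subst (ℕ._≤ toℕ i) (sym j≡0) z≤n)
                                              (λ e′ → i≢j (sym (toℕ-injective e′))))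
    -- `j` is the first and `i` the last position, so nothing precedes or follows them and the
    -- closing arc is a single edge.
    ... | a , b , d , eq , l , l′ with length≡0 a (trans l j≡0) | length≡0 d len
      where
      total : length xs ≡ suc (toℕ i + length d)
      total = trans (cong length eq) (trans (length-++ a) (trans (cong (length a +_) (cong suc (length-++ b)))
        (trans (ℕ.+-suc (length a) _) (cong suc (trans (cong₂ _+_ l (ℕ.+-suc (length b) _))
          (trans (ℕ.+-suc (toℕ j) _) (trans (cong suc (sym (ℕ.+-assoc (toℕ j) _ _))) (cong (_+ length d) l′))))))))
      len : length d ≡ 0
      len = ℕ.+-cancelˡ-≡ (toℕ i) _ _ (trans (ℕ.suc-injective (trans (sym total) (sym e)))
                (sym (ℕ.+-identityʳ _)))
    ...   | refl | refl = proj₂ (arcs-at (closed t) [] b [] eq)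

    edge-next : ∀ i j → toℕ i < toℕ j → lookup xs i ~ lookup xs j → Next i j ⊎ Next j i
    edge-next i j i<j e with lookup-split₂ xs i j i<j
    ... | a , b , d , eq , l , l′ with chordless t a b d eq e
    ...   | inj₁ refl = inj₁ (inj₁ (trans (cong suc (sym (ℕ.+-identityʳ _))) l′))
    ...   | inj₂ []≡ with a | d | []≡
    ...     | [] | [] | _ = inj₂ (inj₂ (
      sym (trans (cong length eq) (cong suc (trans (length-++ b) (trans (ℕ.+-comm _ 1)
        (trans (cong (λ k → suc (k + length b)) l) l′))))) , sym l))
    ...     | _ ∷ _ | [] | ()

    preserves : ∀ i j → (i ≢ j × (Next i j ⊎ Next j i)) → lookup xs i ~ lookup xs j
    preserves i j (n , inj₁ e) = next-edge i j n e
    preserves i j (n , inj₂ e) = ~-sym (next-edge j i (n ∘ sym) e)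

    reflects : ∀ i j → lookup xs i ~ lookup xs j → (i ≢ j × (Next i j ⊎ Next j i))
    reflects i j e with ℕ.<-cmp (toℕ i) (toℕ j)
    ... | tri< i<j n _ = n ∘ cong toℕ , edge-next i j i<j e
    ... | tri≈ _ eq _  = ⊥-elim (~-irr (cong (lookup xs) (toℕ-injective eq)) e)
    ... | tri> _ n j<i = n ∘ cong toℕ , Sum.swap (edge-next j i j<i (~-sym e))

  module _ {u w p q R} (t : Θ u w p q R) (sp : Spanning (vertices u w p q R)) where
    private
      S = vertices u w p q R
      len = lengths 2 2 (suc (length R))

    open Theta len using (Vertex; src; tgt; inner; Step)

    -- Follows the order of `vertices`. The third length is `suc (length R)`, so its inner vertices
    -- are indexed by `Fin (length R)`.
    position : Vertex → Fin (length S)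
    position src = zero
    position tgt = suc zero
    position (inner zero zero) = suc (suc zero)
    position (inner (suc zero) zero) = suc (suc (suc zero))
    position (inner (suc (suc zero)) j) = suc (suc (suc (suc j)))

    vertexAt : Fin (length S) → Vertex
    vertexAt zero = src
    vertexAt (suc zero) = tgt
    vertexAt (suc (suc zero)) = inner zero zero
    vertexAt (suc (suc (suc zero))) = inner (suc zero) zero
    vertexAt (suc (suc (suc (suc j)))) = inner (suc (suc zero)) j

    vertexAt-position : ∀ x → vertexAt (position x) ≡ x
    vertexAt-position src = refl
    vertexAt-position tgt = refl
    vertexAt-position (inner zero zero) = refl
    vertexAt-position (inner (suc zero) zero) = refl
    vertexAt-position (inner (suc (suc zero)) j) = refl

    position-vertexAt : ∀ i → position (vertexAt i) ≡ i
    position-vertexAt zero = refl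
    position-vertexAt (suc zero) = refl
    position-vertexAt (suc (suc zero)) = refl
    position-vertexAt (suc (suc (suc zero))) = refl
    position-vertexAt (suc (suc (suc (suc j)))) = refl

    private
      f : Vertex → V
      f = lookup S ∘ position

    split-at : ∀ j → ∃[ a ] ∃[ b ] (R ≡ a ++ lookup R j ∷ b × length a ≡ toℕ j ×
               Path u a (lookup R j) × Path (lookup R j) b w)
    split-at j with lookup-split R j
    ... | a , b , eq , l = a , b , eq , l , split a (subst (λ R → Path u R w) eq (path t))

    src-path : ∀ j → u ~ lookup R j → toℕ j ≡ 0
    src-path j e with lookup-split R j
    ... | [] , _ , _ , l = sym l
    ... | a@(_ ∷ _) , b , eq , _ = ⊥-elim (hub-path a b (subst (Θ u w p q) eq t) [] (~-sym e) (s≤s z≤n)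
                                   (subst (λ R → Unique (vertices u w p q R)) eq (unique t)))

    path-tgt : ∀ j → lookup R j ~ w → suc (toℕ j) ≡ length R
    path-tgt j e with lookup-split R j
    ... | a , [] , eq , l = sym (trans (cong length eq) (trans (length-++ a)
                              (trans (ℕ.+-comm _ 1) (cong suc l))))
    ... | a , b@(_ ∷ _) , eq , l =
        -- Reversing the theta turns an edge to the second hub into one at the first, where
        -- `hub-path` applies.
        ⊥-elim (hub-path (reverse b) (reverse a) (subst (Θ w u p q) eq′ (flip t)) [] e
            (subst (1 ≤_) (cong length (sym (++-identityʳ (reverse b)))) (1≤reverse b (s≤s z≤n)))
            (subst (λ R → Unique (vertices w u p q R)) eq′ (unique (flip t))))
      where
      eq′ : reverse R ≡ reverse b ++ lookup R j ∷ reverse a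
      eq′ = trans (cong reverse eq) (trans (reverse-++ a (lookup R j ∷ b))
              (trans (cong (_++ reverse a) (unfold-reverse (lookup R j) b)) (++-assoc (reverse b) _ _)))

    path-path′ : ∀ i j → toℕ i < toℕ j → lookup R i ~ lookup R j → suc (toℕ i) ≡ toℕ j
    path-path′ i j i<j e with lookup-split₂ R i j i<j
    ... | a , [] , d , eq , _ , l = trans (cong suc (sym (ℕ.+-identityʳ _))) l
    ... | a , b@(_ ∷ _) , d , eq , _ , l =
        ⊥-elim (path-path a b d (subst (Θ u w p q) eq t) [] (~-sym e) (s≤s z≤n)
                                   (subst (λ R → Unique (vertices u w p q R)) eq (unique t)))

    mid-path : ∀ {p q} → Θ u w p q R → ∀ j → p ~ lookup R j → ⊥
    mid-path {p} {q} t j e with lookup-split R j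
    ... | a , b , eq , _ = path-mid a b (subst (Θ u w p q) eq t) [] (~-sym e)
                             (subst (λ R → Unique (vertices u w p q R)) eq (unique t))

    step-edge : ∀ x y → Step x y → f x ~ f y
    step-edge src tgt (zero , ())
    step-edge src tgt (suc zero , ())
    step-edge src tgt (suc (suc zero) , e) = ⊥-elim (ℕ.<⇒≱ (1≤R t) (ℕ.≤-reflexive (ℕ.suc-injective e)))
    step-edge src (inner zero zero) _ = u~p t
    step-edge src (inner (suc zero) zero) _ = u~q t
    step-edge src (inner (suc (suc zero)) j) j≡0 with split-at j
    ... | a , b , eq , l , P , _ with length≡0 a (trans l j≡0)
    ...   | refl = P
    step-edge (inner zero zero) tgt _ = p~w t
    step-edge (inner (suc zero) zero) tgt _ = q~w t
    step-edge (inner (suc (suc zero)) j) tgt e with split-at j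
    ... | a , b , eq , l , _ , P with length≡0 b (ℕ.+-cancelˡ-≡ (length a) _ _
                                        (ℕ.suc-injective (trans (sym (ℕ.+-suc (length a) _))
                                        (trans (sym (trans (cong length eq) (length-++ a)))
                                          (trans (sym (ℕ.suc-injective e))
                                            (cong suc (trans (sym l) (sym (ℕ.+-identityʳ _)))))))))
    ...   | refl = P
    step-edge (inner zero zero) (inner zero zero) (refl , ())
    step-edge (inner (suc zero) zero) (inner (suc zero) zero) (refl , ())
    step-edge (inner (suc (suc zero)) i) (inner _ j) (refl , e) with lookup-split₂ R i j (ℕ.≤-reflexive e)
    ... | a , b , d , eq , _ , l with length≡0 b (ℕ.+-cancelˡ-≡ (toℕ i) _ _
            (trans (ℕ.suc-injective (trans l (sym e))) (sym (ℕ.+-identityʳ _))))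
    ...   | refl = proj₁ (proj₂ (split a (subst (λ R → Path u R w) eq (path t))))

    edge-step : ∀ x y → f x ~ f y → Step x y ⊎ Step y x
    edge-step src src e = ⊥-elim (~-irr refl e)
    edge-step src tgt e = ⊥-elim (no-triangle (u~p t) (p~w t) (~-sym e))
    edge-step src (inner zero zero) e = inj₁ refl
    edge-step src (inner (suc zero) zero) e = inj₁ refl
    edge-step src (inner (suc (suc zero)) j) e = inj₁ (src-path j e)
    edge-step tgt src e = ⊥-elim (no-triangle (u~p t) (p~w t) e)
    edge-step tgt tgt e = ⊥-elim (~-irr refl e)
    edge-step tgt (inner zero zero) e = inj₂ refl
    edge-step tgt (inner (suc zero) zero) e = inj₂ refl
    edge-step tgt (inner (suc (suc zero)) j) e = inj₂ (cong suc (path-tgt j (~-sym e)))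
    edge-step (inner zero zero) src e = inj₂ refl
    edge-step (inner (suc zero) zero) src e = inj₂ refl
    edge-step (inner (suc (suc zero)) j) src e = inj₂ (src-path j (~-sym e))
    edge-step (inner zero zero) tgt e = inj₁ refl
    edge-step (inner (suc zero) zero) tgt e = inj₁ refl
    edge-step (inner (suc (suc zero)) j) tgt e = inj₁ (cong suc (path-tgt j e))
    edge-step (inner zero zero) (inner zero zero) e = ⊥-elim (~-irr refl e)
    edge-step (inner zero zero) (inner (suc zero) zero) e = ⊥-elim (mid-mid t [] (~-sym e) (unique t))
    edge-step (inner zero zero) (inner (suc (suc zero)) j) e = ⊥-elim (mid-path t j e)
    edge-step (inner (suc zero) zero) (inner zero zero) e = ⊥-elim (mid-mid t [] e (unique t))
    edge-step (inner (suc zero) zero) (inner (suc zero) zero) e = ⊥-elim (~-irr refl e)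
    edge-step (inner (suc zero) zero) (inner (suc (suc zero)) j) e = ⊥-elim (mid-path (swap t) j e)
    edge-step (inner (suc (suc zero)) j) (inner zero zero) e = ⊥-elim (mid-path t j (~-sym e))
    edge-step (inner (suc (suc zero)) j) (inner (suc zero) zero) e =
        ⊥-elim (mid-path (swap t) j (~-sym e))
    edge-step (inner (suc (suc zero)) i) (inner (suc (suc zero)) j) e with ℕ.<-cmp (toℕ i) (toℕ j)
    ... | tri< i<j _ _ = inj₁ (refl , path-path′ i j i<j e)
    ... | tri≈ _ eq _  = ⊥-elim (~-irr (cong (lookup R) (toℕ-injective eq)) e)
    ... | tri> _ _ j<i = inj₂ (refl , path-path′ j i j<i (~-sym e))

    theta-≅ : G ≅ θ 2 2 (suc (length R))
    theta-≅ = bijection⇒≅ G (θ 2 2 (suc (length R))) f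
      (λ x y e → trans (sym (vertexAt-position x)) (trans
        (cong vertexAt (Unique⇒lookup-injective (unique t) _ _ e)) (vertexAt-position y)))
      (λ v → vertexAt (index (sp v)) ,
        trans (cong (lookup S) (position-vertexAt (index (sp v)))) (sym (lookup-index (sp v))))
      (λ { x y (_ , inj₁ s) → step-edge x y s ; x y (_ , inj₂ s) → ~-sym (step-edge y x s) })
      (λ x y e → (λ { refl → ~-irr refl e }) , edge-step x y e)

  complete-≅ : ∀ {u w ls} → Kθ u w ls → Spanning (u ∷ w ∷ ls) → G ≅ K[ 2 , length ls ]
  complete-≅ {u} {w} {ls} t sp = bijection⇒≅ G K[ 2 , length ls ] f inj surj preserves reflects
    where
    position′ : Fin 2 ⊎ Fin (length ls) → Fin (length (u ∷ w ∷ ls))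
    position′ (inj₁ zero) = zero
    position′ (inj₁ (suc zero)) = suc zero
    position′ (inj₂ j) = suc (suc j)

    f : Fin 2 ⊎ Fin (length ls) → V
    f = lookup (u ∷ w ∷ ls) ∘ position′

    inj : ∀ a b → f a ≡ f b → a ≡ b
    inj a b e = go a b (Unique⇒lookup-injective (uniqueᴷ t) (position′ a) (position′ b) e)
      where
      go : ∀ a b → position′ a ≡ position′ b → a ≡ b
      go (inj₁ zero) (inj₁ zero) _ = refl
      go (inj₁ zero) (inj₁ (suc zero)) ()
      go (inj₁ (suc zero)) (inj₁ zero) ()
      go (inj₁ (suc zero)) (inj₁ (suc zero)) _ = refl
      go (inj₁ zero) (inj₂ _) ()
      go (inj₁ (suc zero)) (inj₂ _) ()
      go (inj₂ _) (inj₁ zero) ()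
      go (inj₂ _) (inj₁ (suc zero)) ()
      go (inj₂ _) (inj₂ _) refl = refl

    surj : ∀ v → ∃[ a ] f a ≡ v
    surj v with lookup-surjective sp v
    ... | zero , e = inj₁ zero , e
    ... | suc zero , e = inj₁ (suc zero) , e
    ... | suc (suc j) , e = inj₂ j , e

    hub-edge : ∀ i j → f (inj₁ i) ~ f (inj₂ j)
    hub-edge zero j = proj₁ (All.lookup (joined t) (∈-lookup j))
    hub-edge (suc zero) j = ~-sym (proj₂ (All.lookup (joined t) (∈-lookup j)))

    preserves : ∀ a b → Graph._~_ K[ 2 , length ls ] a b → f a ~ f b
    preserves (inj₁ i) (inj₂ j) _ = hub-edge i j
    preserves (inj₂ j) (inj₁ i) _ = ~-sym (hub-edge i j)
    preserves (inj₁ _) (inj₁ _) (_ , inj₁ ())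
    preserves (inj₁ _) (inj₁ _) (_ , inj₂ ())
    preserves (inj₂ _) (inj₂ _) (_ , inj₁ ())
    preserves (inj₂ _) (inj₂ _) (_ , inj₂ ())

    no-hub-edge : ∀ {ls} → Kθ u w ls → u ~ w → ⊥
    no-hub-edge (mkKθ [] () _)
    no-hub-edge (mkKθ (j ∷ _) _ _) e = no-triangle (proj₁ j) (proj₂ j) (~-sym e)

    reflects : ∀ a b → f a ~ f b → Graph._~_ K[ 2 , length ls ] a b
    reflects (inj₁ i) (inj₂ j) _ = (λ ()) , inj₁ _
    reflects (inj₂ j) (inj₁ i) _ = (λ ()) , inj₂ _
    reflects (inj₁ zero) (inj₁ zero) e = ⊥-elim (~-irr refl e)
    reflects (inj₁ zero) (inj₁ (suc zero)) e = ⊥-elim (no-hub-edge t e)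
    reflects (inj₁ (suc zero)) (inj₁ zero) e = ⊥-elim (no-hub-edge t (~-sym e))
    reflects (inj₁ (suc zero)) (inj₁ (suc zero)) e = ⊥-elim (~-irr refl e)
    reflects (inj₂ i) (inj₂ j) e = ⊥-elim (leaf-leaf t (∈-lookup i) (∈-lookup j)
      (λ eq → ~-irr eq e) [] e (uniqueᴷ t))

  -- `parity` counts inner vertices, so equal values of `β` at the ends mean an even number of
  -- edges. The ends of a closed path coincide, and the hubs of a theta agree through `p`.
  recognise : InT G
  recognise with shape
  recognise | cyclic {ks = ks} t sp with parity ks (closed t)
  ... | inj₂ (n , _) = ⊥-elim (n refl)
  ... | inj₁ (_ , zero , l) = ⊥-elim (ℕ.<⇒≱ (2≤ks t) (ℕ.≤-reflexive l))
  ... | inj₁ (_ , suc m , l) = isC (suc m) (s≤s z≤n) (subst (λ k → G ≅ C k)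
          (trans (cong suc l) (trans (ℕ.+-comm 2 (suc m * 2)) (cong (_+ 2) (ℕ.*-comm (suc m) 2))))
          (cycle-≅ t sp))
  recognise | thetoid {p = p} {R = R} t sp with parity R (path t)
  ... | inj₂ (n , _) = ⊥-elim (n (β-other (β-proper _ _ (u~p t)) (λ e → β-proper _ _ (p~w t) (sym e))))
  ... | inj₁ (_ , m , l) = isθ (suc m) (s≤s z≤n) (subst (λ k → G ≅ θ 2 2 k)
          (trans (cong suc l) (ℕ.*-comm (suc m) 2)) (theta-≅ t sp))
  recognise | bipartite {ls = ls} t 4≤ sp = isK₂ₙ (length ls ∸ 3) (ℕ.∸-monoˡ-≤ 3 4≤)
    (subst (λ k → G ≅ K[ 2 , k ]) (sym (ℕ.m∸n+n≡m (3≤ls t))) (complete-≅ t sp))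

-- Lists of size 2 as forbidden colours.

module _ {V : Set} (G : Graph V) where

  choosable⇒avoidable : Choosable 2 3 G → Avoidable G
  choosable⇒avoidable ch f with ch (λ v → ∁ ⁅ f v ⁆) (λ v → size (f v))
    where
    size : ∀ x → ∣ ∁ ⁅ x ⁆ ∣ ≡ 2
    size c₀ = refl
    size c₁ = refl
    size c₂ = refl
  ... | c , proper , listed = c , proper ,
    λ v e → x∈∁p⇒x∉p (listed v) (subst (_∈ˢ ⁅ f v ⁆) (sym e) (x∈⁅x⁆ (f v)))

  missing : (p : Subset 3) → ∣ p ∣ ≡ 2 → ∃[ x ] (∀ y → y ≢ x → y ∈ˢ p)
  missing (false ∷ true ∷ true ∷ []) _ = c₀ ,
    λ { c₀ n → ⊥-elim (n refl) ; c₁ _ → there here ; c₂ _ → there (there here) }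
  missing (true ∷ false ∷ true ∷ []) _ = c₁ ,
    λ { c₀ _ → here ; c₁ n → ⊥-elim (n refl) ; c₂ _ → there (there here) }
  missing (true ∷ true ∷ false ∷ []) _ = c₂ ,
    λ { c₀ _ → here ; c₁ _ → there here ; c₂ n → ⊥-elim (n refl) }
  missing (true ∷ true ∷ true ∷ []) ()
  missing (true ∷ false ∷ false ∷ []) ()
  missing (false ∷ true ∷ false ∷ []) ()
  missing (false ∷ false ∷ true ∷ []) ()
  missing (false ∷ false ∷ false ∷ []) ()

  avoidable⇒choosable : Avoidable G → Choosable 2 3 G
  avoidable⇒choosable av L size with av (λ v → proj₁ (missing (L v) (size v)))
  ... | c , proper , avoids = c , proper , λ v → proj₂ (missing (L v) (size v)) (c v) (avoids v)

-- Avoidability of the members of the family.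

avoidable-resp-≅ : ∀ {V W} (H : Graph V) (K : Graph W) → H ≅ K → Avoidable K → Avoidable H
avoidable-resp-≅ _ _ (i , adj) av f with av (f ∘ Inverse.from i)
... | c , proper , avoids = c ∘ Inverse.to i ,
  (λ u v e → proper _ _ (Equivalence.to (adj u v) e)) ,
  λ v e → avoids (Inverse.to i v) (trans e (cong f (sym (Inverse.strictlyInverseʳ i v))))

symmetrised-proper : ∀ {V : Set} {R : V → V → Set} {c : V → Colour} →
                     (∀ u v → u ≢ v → R u v → c u ≢ c v) →
                     ∀ u v → u ≢ v × (R u v ⊎ R v u) → c u ≢ c v
symmetrised-proper h u v (n , inj₁ r) = h u v n r
symmetrised-proper h u v (n , inj₂ r) = h v u (n ∘ sym) r ∘ sym

K₁-avoidable : Avoidable (K 1)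
K₁-avoidable f = (λ v → third (f v) (f v)) ,
  symmetrised-proper (λ { zero zero n _ → ⊥-elim (n refl) }) , λ v → third≢ˡ (f v) (f v)

-- Two forbidden colours at the hubs leave a common colour `z` for both, and a leaf then has only
-- `z` and its own forbidden colour to avoid.
K₂ₙ-avoidable : ∀ n → Avoidable K[ 2 , n ]
K₂ₙ-avoidable n f = c , symmetrised-proper proper , avoids
  where
  z : Colour
  z = third (f (inj₁ zero)) (f (inj₁ (suc zero)))
  c : Fin 2 ⊎ Fin n → Colour
  c (inj₁ _) = z
  c (inj₂ j) = third z (f (inj₂ j))
  proper : ∀ u v → u ≢ v → LeftRight u v → c u ≢ c v
  proper (inj₁ _) (inj₂ j) _ _ e = third≢ˡ z (f (inj₂ j)) (sym e)
  avoids : ∀ v → c v ≢ f v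
  avoids (inj₁ zero)       = third≢ˡ _ _
  avoids (inj₁ (suc zero)) = third≢ʳ (f (inj₁ zero)) _
  avoids (inj₂ j)          = third≢ʳ z _

-- The pairs of end colours that a path with k ≥ 1 inner vertices, each with a
-- forbidden colour, may fail to extend: one pair, or two pairs over the
-- colours other than a (unequal pairs for odd k, equal ones for even k).

data Blocker : Set where
  one : (a b : Colour) → Blocker
  two : (a : Colour) → Blocker

Blocked : Bool → Blocker → Colour → Colour → Set
Blocked _     (one a b) x y = x ≡ a × y ≡ b
Blocked true  (two a)   x y = x ≢ a × y ≢ a × x ≢ y
Blocked false (two a)   x y = x ≢ a × x ≡ y

blocked? : ∀ odd B x y → Dec (Blocked odd B x y)
blocked? _     (one a b) x y = (x Fin.≟ a) ×-dec (y Fin.≟ b)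
blocked? true  (two a)   x y = ¬? (x Fin.≟ a) ×-dec ¬? (y Fin.≟ a) ×-dec ¬? (x Fin.≟ y)
blocked? false (two a)   x y = ¬? (x Fin.≟ a) ×-dec (x Fin.≟ y)

-- Only an upper bound on the failing pairs is needed. For `one a b`, the ends `x` and `b` fail if
-- `x`, `g` and `a` exhaust the colours; if `a ≡ g` nothing fails and the pair listed is a harmless
-- excess. `two a` persists, with its parity switched, only for `g ≡ a`; otherwise a single pair
-- still fails.
prepend : Bool → Blocker → Colour → Blocker
prepend _ (one a b) g = one (third a g) b
prepend odd (two a) g with a Fin.≟ g
... | yes _ = two a
prepend true  (two a) g | no _ = one a g
prepend false (two a) g | no _ = one a (third a g)

Prepend : Bool → Blocker → Colour → Set
Prepend odd B g = ∀ (x y : Colour) → ¬ Blocked (not odd) (prepend odd B g) x y →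
                  Σ[ x′ ∈ Colour ] (x′ ≢ x × x′ ≢ g × ¬ Blocked odd B x′ y)

prepend? : ∀ odd B g → Dec (Prepend odd B g)
prepend? odd B g = all? λ x → all? λ y → ¬? (blocked? (not odd) (prepend odd B g) x y) →-dec
  any? λ x′ → ¬? (x′ Fin.≟ x) ×-dec ¬? (x′ Fin.≟ g) ×-dec ¬? (blocked? odd B x′ y)

prepend-correct : ∀ odd B g → Prepend odd B g
prepend-correct true  (one a b) g =
  from-yes (all? {3} λ a → all? {3} λ b → all? {3} λ g → prepend? true (one a b) g) a b g
prepend-correct false (one a b) g =
  from-yes (all? {3} λ a → all? {3} λ b → all? {3} λ g → prepend? false (one a b) g) a b g
prepend-correct true  (two a) g = from-yes (all? {3} λ a → all? {3} λ g → prepend? true (two a) g) a g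
prepend-correct false (two a) g = from-yes (all? {3} λ a → all? {3} λ g → prepend? false (two a) g) a g

-- Positions are natural numbers rather than elements of `Fin k`, so that dropping the first vertex
-- is a shift by `suc`.
record Fill (f : ℕ → Colour) (k : ℕ) (x y : Colour) : Set where
  field
    colour : ℕ → Colour
    first  : colour 0 ≢ x
    step   : ∀ i → suc i < k → colour i ≢ colour (suc i)
    last   : ∀ i → suc i ≡ k → colour i ≢ y
    avoids : ∀ i → i < k → colour i ≢ f i

-- The parity of `suc k`, matching `fill`, whose paths have `suc k` inner vertices.
odd-suc : ℕ → Bool
odd-suc zero    = true
odd-suc (suc k) = not (odd-suc k)

odd-suc-double : ∀ m → odd-suc (m * 2) ≡ true
odd-suc-double zero    = refl
odd-suc-double (suc m) rewrite odd-suc-double m = refl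

fill : ∀ k f → Σ[ B ∈ Blocker ] (∀ x y → ¬ Blocked (odd-suc k) B x y → Fill f (suc k) x y)
-- A single vertex fails exactly if the end colours and its forbidden colour are all different.
fill zero f = two (f 0) , λ x y nb → let z , z≢x , z≢y , z≢f = single (f 0) x y nb in record
  { colour = λ _ → z ; first = z≢x ; step = λ { _ (s≤s ()) } ; last = λ _ _ → z≢y
  ; avoids = λ { zero _ → z≢f ; (suc _) (s≤s ()) } }
  where
  single : ∀ (g x y : Colour) → ¬ Blocked true (two g) x y → Σ[ z ∈ Colour ] (z ≢ x × z ≢ y × z ≢ g)
  single = from-yes (all? {3} λ g → all? {3} λ x → all? {3} λ y → ¬? (blocked? true (two g) x y) →-dec
    any? λ z → ¬? (z Fin.≟ x) ×-dec ¬? (z Fin.≟ y) ×-dec ¬? (z Fin.≟ g))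
fill (suc k) f with fill k (f ∘ suc)
... | B , rest = prepend (odd-suc k) B (f 0) , λ x y nb →
  let x′ , x′≢x , x′≢f , nb′ = prepend-correct (odd-suc k) B (f 0) x y nb
      open Fill (rest x′ y nb′)
  in record
  { colour = λ { zero → x′ ; (suc i) → colour i }
  ; first  = x′≢x
  ; step   = λ { zero _ → first ∘ sym ; (suc i) (s≤s l) → step i l }
  ; last   = λ { (suc i) e → last i (ℕ.suc-injective e) }
  ; avoids = λ { zero _ → x′≢f ; (suc i) (s≤s l) → avoids i l } }

extend₀ : ∀ {k} → (Fin k → Colour) → ℕ → Colour
extend₀ {zero}  f _       = c₀
extend₀ {suc k} f zero    = f zero
extend₀ {suc k} f (suc i) = extend₀ (f ∘ suc) i

extend₀-toℕ : ∀ {k} (f : Fin k → Colour) j → extend₀ f (toℕ j) ≡ f j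
extend₀-toℕ f zero    = refl
extend₀-toℕ f (suc j) = extend₀-toℕ (f ∘ suc) j

-- Two colours other than `g` are available. For an odd path `two a` blocks no equal pair, and
-- `one a b` blocks at most one.
cycle-ends : ∀ B g → Σ[ x ∈ Colour ] (x ≢ g × ¬ Blocked true B x x)
cycle-ends (one a b) g = from-yes (all? {3} λ a → all? {3} λ b → all? {3} λ g →
  any? {3} λ x → ¬? (x Fin.≟ g) ×-dec ¬? (blocked? true (one a b) x x)) a b g
cycle-ends (two a) g = from-yes (all? {3} λ a → all? {3} λ g →
  any? {3} λ x → ¬? (x Fin.≟ g) ×-dec ¬? (blocked? true (two a) x x)) a g

C-avoidable : ∀ k → odd-suc k ≡ true → Avoidable (C (suc (suc k)))
C-avoidable k odd f with fill k (extend₀ (f ∘ suc))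
... | B , ok with cycle-ends B (f zero)
...   | x , x≢f , nb = c , symmetrised-proper proper , avoids′
  where
  open Fill (ok x x (subst (λ o → ¬ Blocked o B x x) (sym odd) nb))
  c : Fin (suc (suc k)) → Colour
  c zero    = x
  c (suc j) = colour (toℕ j)
  proper : ∀ i j → i ≢ j → (suc (toℕ i) ≡ toℕ j ⊎ (suc (toℕ i) ≡ suc (suc k) × toℕ j ≡ 0)) → c i ≢ c j
  proper zero zero n _ = ⊥-elim (n refl)
  proper zero (suc zero) _ (inj₁ _) = first ∘ sym
  proper (suc i) zero _ (inj₂ (e , _)) = last (toℕ i) (ℕ.suc-injective e)
  proper (suc i) (suc j) _ (inj₁ e) = subst (λ l → colour (toℕ i) ≢ colour l) (ℕ.suc-injective e)
    (step (toℕ i) (subst (ℕ._< suc k) (sym (ℕ.suc-injective e)) (toℕ<n j)))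
  avoids′ : ∀ i → c i ≢ f i
  avoids′ zero    = x≢f
  avoids′ (suc j) e = avoids (toℕ j) (toℕ<n j) (trans e (sym (extend₀-toℕ (f ∘ suc) j)))

-- If `g ≡ h`, two equal pairs are available; `two` never blocks these and `one` blocks at most one.
-- Otherwise there is one equal pair, and the three unequal pairs have different underlying sets, of
-- which `p` and `q` block at most one each. So an equal and an unequal pair survive, and `B` cannot
-- block both.
theta-ends : ∀ (B : Blocker) (g h p q : Colour) → Σ[ x ∈ Colour ] Σ[ y ∈ Colour ]
  (x ≢ g × y ≢ h × ¬ Blocked true (two p) x y × ¬ Blocked true (two q) x y × ¬ Blocked true B x y)
theta-ends = λ
  { (one a b) → from-yes (all? {3} λ a → all? {3} λ b → all? λ g → all?
      λ h → all? λ p → all? λ q → ends? (one a b) g h p q) a b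
  ; (two a)   → from-yes (all? {3} λ a → all? λ g → all?
      λ h → all? λ p → all? λ q → ends? (two a) g h p q) a }
  where
  ends? : ∀ (B : Blocker) (g h p q : Colour) → Dec (Σ[ x ∈ Colour ] Σ[ y ∈ Colour ]
    (x ≢ g × y ≢ h × ¬ Blocked true (two p) x y × ¬ Blocked true (two q) x y × ¬ Blocked true B x y))
  ends? B g h p q = any? λ x → any? λ y → ¬? (x Fin.≟ g) ×-dec ¬? (y Fin.≟ h) ×-dec
    ¬? (blocked? true (two p) x y) ×-dec ¬? (blocked? true (two q) x y) ×-dec ¬? (blocked? true B x y)

θ-avoidable : ∀ k → odd-suc k ≡ true → Avoidable (θ 2 2 (suc (suc k)))
θ-avoidable k odd f with fill k (extend₀ (λ j → f (Theta.inner (suc (suc zero)) j)))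
... | B , ok with theta-ends B (f Theta.src) (f Theta.tgt)
                         (f (Theta.inner zero zero)) (f (Theta.inner (suc zero) zero))
...   | x , y , x≢ , y≢ , np , nq , nb = c , symmetrised-proper proper , avoids′
  where
  open Theta (lengths 2 2 (suc (suc k)))
  open Fill (ok x y (subst (λ o → ¬ Blocked o B x y) (sym odd) nb))
  mid : ∀ g → ¬ Blocked true (two g) x y → Fill (λ _ → g) 1 x y
  mid g = proj₂ (fill 0 (λ _ → g)) x y
  module P = Fill (mid (f (inner zero zero)) np)
  module Q = Fill (mid (f (inner (suc zero) zero)) nq)
  c : Vertex → Colour
  c src = x
  c tgt = y
  c (inner zero j) = P.colour (toℕ j)
  c (inner (suc zero) j) = Q.colour (toℕ j)
  c (inner (suc (suc zero)) j) = colour (toℕ j)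
  proper : ∀ a b → a ≢ b → Step a b → c a ≢ c b
  proper src tgt _ (zero , ())
  proper src tgt _ (suc zero , ())
  proper src tgt _ (suc (suc zero) , ())
  proper src (inner zero zero) _ _ = P.first ∘ sym
  proper src (inner (suc zero) zero) _ _ = Q.first ∘ sym
  proper src (inner (suc (suc zero)) zero) _ _ = first ∘ sym
  proper (inner zero zero) tgt _ _ = P.last 0 refl
  proper (inner (suc zero) zero) tgt _ _ = Q.last 0 refl
  proper (inner (suc (suc zero)) j) tgt _ e = last (toℕ j) (ℕ.suc-injective e)
  proper (inner zero zero) (inner zero zero) n _ = ⊥-elim (n refl)
  proper (inner (suc zero) zero) (inner (suc zero) zero) n _ = ⊥-elim (n refl)
  proper (inner (suc (suc zero)) i) (inner (suc (suc zero)) j) _ (_ , e) =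
    subst (λ l → colour (toℕ i) ≢ colour l) e (step (toℕ i) (subst (ℕ._< suc k) (sym e) (toℕ<n j)))
  avoids′ : ∀ v → c v ≢ f v
  avoids′ src = x≢
  avoids′ tgt = y≢
  avoids′ (inner zero zero) = P.avoids 0 (s≤s z≤n)
  avoids′ (inner (suc zero) zero) = Q.avoids 0 (s≤s z≤n)
  avoids′ (inner (suc (suc zero)) j) e =
    avoids (toℕ j) (toℕ<n j) (trans e (sym (extend₀-toℕ (λ j → f (inner (suc (suc zero)) j)) j)))

InT⇒avoidable : ∀ {V} (H : Graph V) → InT H → Avoidable H
InT⇒avoidable H (isK₁ i) = avoidable-resp-≅ H (K 1) i K₁-avoidable
InT⇒avoidable H (isC m _ i) = avoidable-resp-≅ H (C (2 * m + 2)) i (subst (λ k → Avoidable (C k))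
  (trans (ℕ.+-comm 2 (m * 2)) (cong (_+ 2) (ℕ.*-comm m 2))) (C-avoidable (m * 2) (odd-suc-double m)))
InT⇒avoidable H (isθ (suc m) _ i) =
    avoidable-resp-≅ H (θ 2 2 (2 * suc m)) i (subst (λ k → Avoidable (θ 2 2 k))
  (ℕ.*-comm (suc m) 2) (θ-avoidable (m * 2) (odd-suc-double m)))
InT⇒avoidable H (isK₂ₙ m _ i) = avoidable-resp-≅ H K[ 2 , m + 3 ] i (K₂ₙ-avoidable (m + 3))

-- Degrees, deletion of vertices, and pruning.

module Degrees {n} (G : Graph (Fin n)) where
  open Graph G

  neighbours : ∀ v → List (Fin n)
  neighbours v = filter (v ~?_) (allFin n)

  neighbour⁺ : ∀ {v w} → v ~ w → w ∈ neighbours v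
  neighbour⁺ {v} e = ∈-filter⁺ (v ~?_) (∈-allFin _) e

  neighbour⁻ : ∀ {v w} → w ∈ neighbours v → v ~ w
  neighbour⁻ {v} m = proj₂ (∈-filter⁻ (v ~?_) {xs = allFin n} m)

  degree≡0 : ∀ {v w} → degree G v ≡ 0 → v ~ w → ⊥
  degree≡0 {v} d e with neighbours v | neighbour⁺ e
  degree≡0 () e | _ ∷ _ | _

  degree≡1 : ∀ v → degree G v ≡ 1 → ∃[ w ] (v ~ w × (∀ z → v ~ z → z ≡ w))
  degree≡1 v d with neighbours v in eq
  ... | w ∷ [] = w , neighbour⁻ (subst (w ∈_) (sym eq) (here refl)) ,
    λ z e → case (subst (z ∈_) eq (neighbour⁺ e))
    where
    case : ∀ {z} → z ∈ w ∷ [] → z ≡ w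
    case (here e) = e

  2≤degree : ∀ v → 2 ≤ degree G v → ∀ p → ∃[ z ] (v ~ z × z ≢ p)
  2≤degree v d p with neighbours v in eq | filter⁺ (v ~?_) (allFin⁺ n)
  2≤degree v (s≤s ()) p | _ ∷ [] | _
  ... | a ∷ b ∷ _ | (a≢b ∷ _) ∷ _ with a Fin.≟ p
  ...   | no a≢p   = a , neighbour⁻ (subst (a ∈_) (sym eq) (here refl)) , a≢p
  ...   | yes refl = b , neighbour⁻ (subst (b ∈_) (sym eq) (there (here refl))) , a≢b ∘ sym

deletion-avoidable : ∀ {n} (G : Graph (Fin (suc n))) v → Avoidable G → Avoidable (G - v)
deletion-avoidable G v av f =
  proj₁ (av g) ∘ punchIn v , (λ a b → proj₁ (proj₂ (av g)) (punchIn v a) (punchIn v b)) ,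
  λ u e → proj₂ (proj₂ (av g)) (punchIn v u) (trans e (f≡g u))
  where
  g : Fin _ → Colour
  g u with v Fin.≟ u
  -- Any colour may be forbidden at the deleted vertex.
  ... | yes _  = c₀
  ... | no v≢u = f (punchOut v≢u)
  f≡g : ∀ u → f u ≡ g (punchIn v u)
  f≡g u with v Fin.≟ punchIn v u
  ... | yes e  = ⊥-elim (punchInᵢ≢i v u (sym e))
  ... | no v≢u = cong f (sym (trans (punchOut-cong v refl) (punchOut-punchIn v)))

module Pendant {n} (G : Graph (Fin (suc n))) (v : Fin (suc n)) (deg : degree G v ≡ 1) where
  open Graph G

  private
    w = proj₁ (Degrees.degree≡1 G v deg)
    v~w = proj₁ (proj₂ (Degrees.degree≡1 G v deg))
    only = proj₂ (proj₂ (Degrees.degree≡1 G v deg))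

    v≢w : v ≢ w
    v≢w e = ~-irr e v~w

  -- Colourings and retractions are defined on views, so that statements about an edge are proved by
  -- matching on the views of its two ends.
  data View : Fin (suc n) → Set where
    deleted : View v
    kept    : ∀ u → View (punchIn v u)

  view : ∀ x → View x
  view x with v Fin.≟ x
  ... | yes refl = deleted
  ... | no v≢x   = subst View (punchIn-punchOut v≢x) (kept (punchOut v≢x))

  -- A vertex of degree 1 loses one colour to its neighbour and one to `f`, so a third remains.
  attach-avoidable : Avoidable (G - v) → Avoidable G
  attach-avoidable av f with av (f ∘ punchIn v)
  ... | c , proper , avoids = (λ x → colour (view x)) , (λ x y → ok (view x) (view y)) , λ x → fine (view x)
    where
    colour : ∀ {x} → View x → Colour
    colour deleted  = third (c (punchOut v≢w)) (f v)
    colour (kept u) = c u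
    attached : ∀ u → v ~ punchIn v u → third (c (punchOut v≢w)) (f v) ≢ c u
    attached u e = subst (λ z → third (c (punchOut v≢w)) (f v) ≢ c z)
      (punchIn-injective v _ u (trans (punchIn-punchOut v≢w) (sym (only _ e))))
      (third≢ˡ (c (punchOut v≢w)) (f v))
    ok : ∀ {x y} (p : View x) (q : View y) → x ~ y → colour p ≢ colour q
    ok deleted  deleted  e = ⊥-elim (~-irr refl e)
    ok deleted  (kept u) e = attached u e
    ok (kept u) deleted  e = attached u (~-sym e) ∘ sym
    ok (kept a) (kept b) e = proper a b e
    fine : ∀ {x} (p : View x) → colour p ≢ f x
    fine deleted  = third≢ʳ (c (punchOut v≢w)) (f v)
    fine (kept u) = avoids u

  -- Walks are pushed into G - v by retracting v onto its only neighbour.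

  deletion-connected : Connected G → Connected (G - v)
  deletion-connected (_ , conn) = punchOut v≢w , λ a b →
    subst₂ (Star (Graph._~_ (G - v))) (retract-kept a (view (punchIn v a)))
           (retract-kept b (view (punchIn v b)))
      (kleisliStar (retract ∘ view) (λ {x} {y} → push (view x) (view y)) (conn (punchIn v a) (punchIn v b)))
    where
    w′ = punchOut v≢w
    retract : ∀ {x} → View x → Fin n
    retract deleted  = w′
    retract (kept u) = u
    retract-kept : ∀ a (p : View (punchIn v a)) → retract p ≡ a
    retract-kept a p = go p refl
      where
      go : ∀ {x} (p : View x) → x ≡ punchIn v a → retract p ≡ a
      go deleted  e = ⊥-elim (punchInᵢ≢i v a (sym e))
      go (kept u) e = punchIn-injective v u a e
    w′-only : ∀ u → v ~ punchIn v u → w′ ≡ u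
    w′-only u e = punchIn-injective v w′ u (trans (punchIn-punchOut v≢w) (sym (only _ e)))
    push : ∀ {x y} (p : View x) (q : View y) → x ~ y → Star (Graph._~_ (G - v)) (retract p) (retract q)
    push deleted  deleted  e = ⊥-elim (~-irr refl e)
    push deleted  (kept u) e = subst (Star _ w′) (w′-only u e) ε
    push (kept u) deleted  e = subst (λ z → Star _ z w′) (w′-only u (~-sym e)) ε
    push (kept a) (kept b) e = e ◅ ε

prunesTo-avoidable : ∀ {n m} {G : Graph (Fin n)} {H : Graph (Fin m)} → G prunesTo H →
                     (Avoidable G → Avoidable H) × (Avoidable H → Avoidable G)
prunesTo-avoidable stop = id , id
prunesTo-avoidable (prune {G = G} v deg p) with prunesTo-avoidable p
... | to , from = to ∘ deletion-avoidable G v , Pendant.attach-avoidable G v deg ∘ from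

prunesTo-connected : ∀ {n m} {G : Graph (Fin n)} {H : Graph (Fin m)} → G prunesTo H →
                     Connected G → Connected H
prunesTo-connected stop conn = conn
prunesTo-connected (prune {G = G} v deg p) conn =
    prunesTo-connected p (Pendant.deletion-connected G v deg conn)

isolated⇒K₁ : ∀ {n} (H : Graph (Fin n)) → Connected H → ∀ v → degree H v ≡ 0 → H ≅ K 1
isolated⇒K₁ H (_ , conn) v d = mk↔ₛ′ (λ _ → zero) (λ _ → v) (λ { zero → refl }) (λ x → alone (conn v x)) ,
  λ a b → mk⇔ (λ e → ⊥-elim (Degrees.degree≡0 H d
                (subst (λ x → Graph._~_ H x b) (sym (alone (conn v a))) e)))
              (λ (n , _) → ⊥-elim (n refl))
  where
  alone : ∀ {x} → Star (Graph._~_ H) v x → v ≡ x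
  alone ε       = refl
  alone (e ◅ _) = ⊥-elim (Degrees.degree≡0 H d e)

-- By connectedness an isolated vertex is the whole graph. Without one, every degree is at least 2,
-- which lets a walk leave each vertex by a neighbour other than the one it came from.
core-avoidable⇒InT : ∀ {n} (H : Graph (Fin n)) → Connected H → (∀ v → degree H v ≡ 0 ⊎ 2 ≤ degree H v) →
                     Avoidable H → InT H
core-avoidable⇒InT H conn deg av with any? (λ v → degree H v ℕ.≟ 0)
... | yes (v , d) = isK₁ (isolated⇒K₁ H conn v d)
... | no none = Recognition.recognise H av
  (λ v → Degrees.2≤degree H v ([ (λ d → ⊥-elim (none (v , d))) , id ]′ (deg v))) conn

theorem4p2 : ∀ {n m : ℕ} (G : Graph (Fin n)) (H : Graph (Fin m)) →
    Connected G → H IsCoreOf G →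
    Choosable 2 3 G ⇔ InT H
theorem4p2 G H conn (pr , deg) = mk⇔
  (λ ch → core-avoidable⇒InT H (prunesTo-connected pr conn) deg
            (proj₁ (prunesTo-avoidable pr) (choosable⇒avoidable G ch)))
  (λ inT → avoidable⇒choosable G (proj₂ (prunesTo-avoidable pr) (InT⇒avoidable H inT)))
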